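{- Let $G$ be a simple, finite, connected graph with vertex set $V=\{v_1,\dots,v_n\}$ and let $M_G$ be a mixed graph with underlying graph $G$. Suppose $M_G$ has property $SP$. Then all cofactors of the Hermitian Laplacian matrix of the second kind $L(M_G)$ have the same absolute value, and this common absolute value equals the number of spanning trees of $G$.
   Context: A mixed graph $M_G$ is obtained from a simple graph $G$ (its underlying graph) by giving directions to some of the edges of $G$; an edge directed from $v_i$ to $v_j$ is written $v_i\to v_j$, an undirected edge $v_i\leftrightarrow v_j$. Let $\omega=\frac{1+\sqrt{3}\mathbf{i}}{2}$. The Hermitian adjacency matrix of the second kind is the $n\times n$ matrix $N(M_G)=(n_{ij})$ with $n_{ij}=1$ if $v_i\leftrightarrow v_j$, $n_{ij}=\omega$ if $v_i\to v_j$, $n_{ij}=\overline{\omega}=\frac{1-\sqrt{3}\mathbf{i}}{2}$ if $v_j\to v_i$, and $n_{ij}=0$ otherwise. With $D(M_G)$ the diagonal matrix of vertex degrees of $G$, the Hermitian Laplacian matrix of the second kind is $L(M_G)=D(M_G)-N(M_G)$. The $(i,j)$ cofactor is $(-1)^{i+j}\det$ of the submatrix obtained by deleting row $i$ and column $j$. The mixed graph $M_G$ has property $SP$ if $V$ can be partitioned into six (possibly empty) parts $V_1,\dots,V_6$ such that every undirected edge has both endpoints in the same part $V_i$, and every directed edge goes from some vertex of $V_i$ to some vertex of $V_{i+1}$ for some $i\in\{1,\dots,5\}$, or from a vertex of $V_6$ to a vertex of $V_1$. -}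

module Defs where

open import Data.Nat as ℕ using (ℕ; zero; suc)
open import Data.Integer as ℤ using (ℤ; +_)
open import Data.Fin as Fin using (Fin; zero; suc; toℕ; punchIn)
open import Data.Vec using (Vec; lookup)
open import Data.Bool using (Bool; true; false; if_then_else_)
open import Data.List using (List; []; _∷_; length)
open import Data.List.Relation.Unary.Unique.Propositional using (Unique)
open import Data.Product using (Σ; _×_; _,_)
open import Relation.Binary.PropositionalEquality using (_≡_; _≢_)
open import Relation.Nullary using (¬_; does)

-- Eisenstein integers ℤ[ω], ω = (1 + √3 i)/2, so ω² = ω - 1 and
-- conj ω = 1 - ω.  An element  re + im·ω.  All entries of L(M_G) and
-- hence all cofactors live here.

record ℤω : Set where
  constructor _+_ω
  field
    re : ℤ
    im : ℤ
open ℤω public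

0ω 1ω ω ω̄ : ℤω
0ω = (+ 0) + (+ 0) ω
1ω = (+ 1) + (+ 0) ω
ω  = (+ 0) + (+ 1) ω
ω̄  = (+ 1) + (ℤ.- (+ 1)) ω

infixl 6 _⊕_ _⊖_
infixl 7 _⊛_

_⊕_ : ℤω → ℤω → ℤω
(a + b ω) ⊕ (c + d ω) = (a ℤ.+ c) + (b ℤ.+ d) ω

⊖_ : ℤω → ℤω
⊖ (a + b ω) = (ℤ.- a) + (ℤ.- b) ω

_⊖_ : ℤω → ℤω → ℤω
x ⊖ y = x ⊕ (⊖ y)

-- (a + bω)(c + dω) = ac + (ad + bc)ω + bd ω² = (ac - bd) + (ad + bc + bd)ω
_⊛_ : ℤω → ℤω → ℤω
(a + b ω) ⊛ (c + d ω) = (a ℤ.* c ℤ.- b ℤ.* d) + (a ℤ.* d ℤ.+ b ℤ.* c ℤ.+ b ℤ.* d) ω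

fromℕω : ℕ → ℤω
fromℕω k = (+ k) + (+ 0) ω

-- squared absolute value: |a + bω|² = (a + b/2)² + 3b²/4 = a² + ab + b²
normω : ℤω → ℤ
normω (a + b ω) = a ℤ.* a ℤ.+ a ℤ.* b ℤ.+ b ℤ.* b

Matrix : ℕ → Set
Matrix n = Fin n → Fin n → ℤω

Σω : ∀ {n} → (Fin n → ℤω) → ℤω
Σω {zero}  f = 0ω
Σω {suc n} f = f zero ⊕ Σω (λ i → f (suc i))

signω : ℕ → ℤω
signω zero          = 1ω
signω (suc zero)    = ⊖ 1ω
signω (suc (suc k)) = signω k

minor : ∀ {n} → Matrix (suc n) → Fin (suc n) → Fin (suc n) → Matrix n
minor M i j r c = M (punchIn i r) (punchIn j c)

det : ∀ {n} → Matrix n → ℤω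
det {zero}  M = 1ω
det {suc n} M = Σω (λ j → signω (toℕ j) ⊛ M zero j ⊛ det (minor M zero j))

cofactor : ∀ {n} → Matrix n → Fin n → Fin n → ℤω
cofactor {suc n} M i j = signω (toℕ i ℕ.+ toℕ j) ⊛ det (minor M i j)

-- Mixed graphs on vertex set Fin n (v_{i+1} ↔ i).
-- arc i j: none = not adjacent, und = i ↔ j, fwd = i → j, bwd = j → i.

data Arc : Set where
  none und fwd bwd : Arc

rev : Arc → Arc
rev none = none
rev und  = und
rev fwd  = bwd
rev bwd  = fwd

record MixedGraph (n : ℕ) : Set where
  field
    arc     : Fin n → Fin n → Arc
    loopless : ∀ i → arc i i ≡ none
    consistent : ∀ i j → arc j i ≡ rev (arc i j)
open MixedGraph public

isEdge : Arc → Bool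
isEdge none = false
isEdge _    = true

Adj : ∀ {n} → MixedGraph n → Fin n → Fin n → Set
Adj M i j = isEdge (arc M i j) ≡ true

data Walk {n : ℕ} (E : Fin n → Fin n → Set) : Fin n → Fin n → Set where
  [] : ∀ {i} → Walk E i i
  _∷_ : ∀ {i k j} → E i k → Walk E k j → Walk E i j

Connected : ∀ {n} → (Fin n → Fin n → Set) → Set
Connected E = ∀ i j → Walk E i j

ChainFrom : ∀ {n} → (Fin n → Fin n → Set) → Fin n → Fin n → List (Fin n) → Set
ChainFrom E first prev []       = E prev first
ChainFrom E first prev (v ∷ vs) = E prev v × ChainFrom E first v vs

IsCycle : ∀ {n} → (Fin n → Fin n → Set) → List (Fin n) → Set
IsCycle E []       = Data.Empty.⊥ where import Data.Empty
IsCycle E (v ∷ vs) = (2 ℕ.≤ length vs) × Unique (v ∷ vs) × ChainFrom E v v vs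

Acyclic : ∀ {n} → (Fin n → Fin n → Set) → Set
Acyclic E = ∀ cs → ¬ IsCycle E cs

degree : ∀ {n} → MixedGraph n → Fin n → ℕ
degree {zero}  M i = 0
degree {suc n} M i = go (λ j → isEdge (arc M i j))
  where
  go : ∀ {m} → (Fin m → Bool) → ℕ
  go {zero}  f = 0
  go {suc m} f = (if f zero then 1 else 0) ℕ.+ go (λ j → f (suc j))

entryN : Arc → ℤω
entryN none = 0ω
entryN und  = 1ω
entryN fwd  = ω
entryN bwd  = ω̄

N : ∀ {n} → MixedGraph n → Matrix n
N M i j = entryN (arc M i j)

D : ∀ {n} → MixedGraph n → Matrix n
D M i j = if does (i Fin.≟ j) then fromℕω (degree M i) else 0ω

L : ∀ {n} → MixedGraph n → Matrix n
L M i j = D M i j ⊖ N M i j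

SubAdj : ∀ {n} → Vec (Vec Bool n) n → Fin n → Fin n → Set
SubAdj T i j = lookup (lookup T i) j ≡ true

record IsSpanningTree {n} (M : MixedGraph n) (T : Vec (Vec Bool n) n) : Set where
  field
    symmetric : ∀ i j → lookup (lookup T i) j ≡ lookup (lookup T j) i
    subgraph  : ∀ i j → SubAdj T i j → Adj M i j
    connected : Connected (SubAdj T)
    acyclic   : Acyclic (SubAdj T)

-- the type of spanning trees of G (proof component irrelevant, so
-- equality of spanning trees is equality of edge sets)
record SpanningTree {n} (M : MixedGraph n) : Set where
  constructor spanningTree
  field
    edges : Vec (Vec Bool n) n
    .isTree : IsSpanningTree M edges

-- property SP: a partition V_1..V_6 given by a labelling f : Fin n → Fin 6
next6 : Fin 6 → Fin 6
next6 zero                               = suc zero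
next6 (suc zero)                         = suc (suc zero)
next6 (suc (suc zero))                   = suc (suc (suc zero))
next6 (suc (suc (suc zero)))             = suc (suc (suc (suc zero)))
next6 (suc (suc (suc (suc zero))))       = suc (suc (suc (suc (suc zero))))
next6 (suc (suc (suc (suc (suc zero))))) = zero

PropertySP : ∀ {n} → MixedGraph n → Set
PropertySP {n} M = Σ (Fin n → Fin 6) λ f →
  (∀ i j → arc M i j ≡ und → f i ≡ f j) ×
  (∀ i j → arc M i j ≡ fwd → f j ≡ next6 (f i))

{-# OPTIONS --safe #-}
-- Write p_x = ω^(f x) for the labelling f given by property SP.  Then p_l · n_lx = p_x along every edge, so with
-- v_x = p_x e_x the l-th row of the Laplacian satisfies p_l L_l = Σ_x (v_l − v_x), the sum over the neighbours x
-- of l.  The cofactor at (i , j) is the determinant of L with row i replaced by e_j.  Expanding the remaining rows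
-- multilinearly gives one determinant, with rows v_l − v_(g l) and v_j, for every choice g of a neighbour of each
-- vertex other than i.  If g runs into a cycle, the rows along the cycle add up to 0; otherwise following g leads
-- every vertex to i, and row operations turn the matrix into the one with rows v_x, of determinant Π p_x.  The
-- latter g are the spanning trees oriented towards i, and |p_x| = 1, so the cofactor has absolute value their number.
module Submission where

open import Defs
open import Algebra.Bundles using (CommutativeRing)
open import Data.Bool as Bool using (Bool; true; false; if_then_else_)
import Data.Bool.Properties as Bool
open import Data.Fin as Fin using (Fin; zero; suc; toℕ; fromℕ<; punchIn; punchOut)
open import Data.Fin.Permutation using (↔⇒≡)
open import Data.Fin.Properties
  using (punchInᵢ≢i; punchIn-injective; punchIn-punchOut; punchOut-injective; pigeonhole; toℕ<n; toℕ-fromℕ<;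
         toℕ-injective; all?; any?; ¬∀⟶∃¬)
open import Data.Integer as ℤ using (+_)
import Data.Integer.Properties as ℤ
open import Data.Integer.Tactic.RingSolver using (solve-∀)
open import Data.List as List
  using (List; []; _∷_; _++_; map; filter; length; allFin; cartesianProductWith; tabulate)
open import Data.List.Membership.Propositional using (_∈_)
open import Data.List.Membership.Propositional.Properties
  using (∈-lookup; ∈-filter⁺; ∈-filter⁻; ∈-cartesianProductWith⁺; ∈-allFin)
open import Data.List.Relation.Unary.All as All using (All; []; _∷_)
open import Data.List.Relation.Unary.All.Properties using (¬Any⇒All¬; All¬⇒¬Any)
open import Data.List.Relation.Unary.AllPairs using ([]; _∷_)
open import Data.List.Relation.Unary.Any as Any using (here; there)
open import Data.List.Relation.Unary.Any.Properties using (lookup-index)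
open import Data.List.Relation.Unary.Unique.Propositional using (Unique)
open import Data.List.Relation.Unary.Unique.Propositional.Properties using (allFin⁺; filter⁺; cartesianProductWith⁺)
open import Data.Nat as ℕ using (ℕ; zero; suc; _≤_; _<_; s≤s; z≤n)
open import Data.Nat.GeneralisedArithmetic using (iterate)
import Data.Nat.Properties as ℕ
open import Data.Product using (_×_; _,_; proj₁; proj₂; ∃; ∃₂)
open import Data.Sum using (_⊎_; inj₁; inj₂; swap; [_,_]′)
open import Data.Vec as Vec using (Vec; []; _∷_; lookup)
open import Data.Vec.Functional using (Vector; updateAt)
open import Data.Vec.Functional.Properties using (updateAt-updates; updateAt-minimal; map-updateAt-local)
open import Data.Vec.Properties using (lookup∘tabulate; tabulate∘lookup; tabulate-cong; ≡-dec; ∷-injective)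
open import Function using (_∘_; id; mk⤖)
open import Function.Bundles using (_⤖_)
open import Function.Consequences.Propositional using (strictlySurjective⇒surjective)
open import Function.Properties.Bijection using (⤖⇒↔)
open import Function.Properties.Inverse using (↔-sym; ↔-trans)
import Level
open import Relation.Binary.PropositionalEquality as ≡ using (_≡_; _≢_; isEquivalence)
open import Relation.Nullary using (¬_; Dec; yes; no; does; contradiction)
open import Relation.Nullary.Decidable using (map′; _×-dec_; _⊎-dec_; _→-dec_; ¬?; dec-true; dec-false)
open import Relation.Nullary.Negation using (contradiction-irr)
open import Relation.Unary using (Pred; Decidable)

-- `det` is given only by expansion along the first row, so every property of determinants is
-- derived from that recursion and from linearity in a single row. Replacing row `i` by a unit row
-- turns each cofactor, on or off the diagonal, into a full determinant, and all pairs `(i , j)` are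
-- treated alike. The choices `g` are extended to the root by `g i = i`. The root then absorbs every
-- orbit that meets it, and whether following `g` leads to `i` can be read off the n-th iterate,
-- because an orbit enters its cycle within n steps. Row `i` is scaled by p_j instead of p_i, since
-- it has to become v_j. The unit factors on the two sides of the resulting identity may therefore
-- differ; they disappear on passing to the multiplicative squared norm. The count obtained depends
-- on the row `i` a priori. It becomes the same for all rows because, for each root, the rooted `g`
-- are in bijection with one and the same set of spanning trees.

infixl 9 _[_≔_]

_[_≔_] : ∀ {a} {A : Set a} {n} → Vector A n → Fin n → A → Vector A n
xs [ i ≔ x ] = updateAt xs i (λ _ → x)

≔-elim : ∀ {a p n} {A : Set a} (P : Fin n → A → Set p) {xs : Vector A n} {i x} →
  P i x → (∀ l → l ≢ i → P l (xs l)) → ∀ l → P l ((xs [ i ≔ x ]) l)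
≔-elim P {xs} {i} {x} pi pl l with l Fin.≟ i
... | yes ≡.refl = ≡.subst (P l) (≡.sym (updateAt-updates l xs)) pi
... | no  l≢i    = ≡.subst (P l) (≡.sym (updateAt-minimal l i xs l≢i)) (pl l l≢i)

-- The position of column j once column punchIn j c has been deleted.
coPunch : ∀ {n} → Fin (suc n) → Fin n → Fin n
coPunch zero    zero    = zero
coPunch zero    (suc c) = zero
coPunch (suc j) zero    = j
coPunch (suc j) (suc c) = suc (coPunch j c)

punchIn-coPunch : ∀ {n} (j : Fin (suc n)) c → punchIn (punchIn j c) (coPunch j c) ≡ j
punchIn-coPunch zero    zero    = ≡.refl
punchIn-coPunch zero    (suc c) = ≡.refl
punchIn-coPunch (suc j) zero    = ≡.refl
punchIn-coPunch (suc j) (suc c) = ≡.cong suc (punchIn-coPunch j c)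

-- Two columns may be deleted in either order. This identifies the double minors when a first-row
-- expansion is compared with the expansion of a minor.
punchIn-swap : ∀ {n} (j : Fin (suc (suc n))) c x →
  punchIn (punchIn j c) (punchIn (coPunch j c) x) ≡ punchIn j (punchIn c x)
punchIn-swap zero    zero    x       = ≡.refl
punchIn-swap zero    (suc c) x       = ≡.refl
punchIn-swap (suc j) zero    x       = ≡.refl
punchIn-swap (suc j) (suc c) zero    = ≡.refl
punchIn-swap (suc j) (suc c) (suc x) = ≡.cong suc (punchIn-swap j c x)

thirdIndex : ∀ {n} (r s : Fin (suc (suc (suc n)))) → ∃ λ t → t ≢ r × t ≢ s
thirdIndex zero          zero          = suc zero , (λ ()) , (λ ())
thirdIndex zero          (suc zero)    = suc (suc zero) , (λ ()) , (λ ())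
thirdIndex zero          (suc (suc _)) = suc zero , (λ ()) , (λ ())
thirdIndex (suc zero)    zero          = suc (suc zero) , (λ ()) , (λ ())
thirdIndex (suc (suc _)) zero          = suc zero , (λ ()) , (λ ())
thirdIndex (suc _)       (suc _)       = zero , (λ ()) , (λ ())

-- Determinants over a commutative ring

module Determinant {c ℓ} (R : CommutativeRing c ℓ) where

  open CommutativeRing R hiding (zero)
  open import Algebra.Properties.Ring ring using (-‿distribˡ-*; -‿involutive)
  open import Algebra.Properties.Semiring.Sum semiring
    using (sum; sum-cong-≋; sum-replicate-zero; sum-remove; ∑-distrib-+; *-distribˡ-sum)
  open import Algebra.Solver.Ring.NaturalCoefficients.Default commutativeSemiring
    using (solve; _:=_; _:+_; _:*_; con)
  open import Relation.Binary.Reasoning.Setoid setoid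

  Row : ℕ → Set c
  Row = Vector Carrier

  SquareMatrix : ℕ → Set c
  SquareMatrix n = Vector (Row n) n

  private
    variable
      m n : ℕ

  product : Row n → Carrier
  product {zero}  f = 1#
  product {suc n} f = f zero * product (f ∘ suc)

  product-one : ∀ {f : Row n} → (∀ k → f k ≈ 1#) → product f ≈ 1#
  product-one {zero}  f≈1 = refl
  product-one {suc n} f≈1 = trans (*-cong (f≈1 zero) (product-one (f≈1 ∘ suc))) (*-identityˡ 1#)

  product-zero : ∀ {f : Row n} k → f k ≈ 0# → product f ≈ 0#
  product-zero zero    fk≈0 = trans (*-congʳ fk≈0) (zeroˡ _)
  product-zero (suc k) fk≈0 = trans (*-congˡ (product-zero k fk≈0)) (zeroʳ _)

  sum-zero : ∀ {f : Row n} → (∀ k → f k ≈ 0#) → sum f ≈ 0#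
  sum-zero {n} f≈0 = trans (sum-cong-≋ f≈0) (sum-replicate-zero n)

  sum-single : ∀ (j : Fin n) (f : Row n) → (∀ k → k ≢ j → f k ≈ 0#) → sum f ≈ f j
  sum-single {suc n} j f f≈0 = begin
    sum f                      ≈⟨ sum-remove f ⟩
    f j + sum (f ∘ punchIn j)  ≈⟨ +-congˡ (sum-zero λ c → f≈0 (punchIn j c) (punchInᵢ≢i j c)) ⟩
    f j + 0#                   ≈⟨ +-identityʳ (f j) ⟩
    f j                        ∎

  sum-linear : ∀ a b (f g : Row n) → sum (λ k → a * f k + b * g k) ≈ a * sum f + b * sum g
  sum-linear a b f g = begin
    sum (λ k → a * f k + b * g k)              ≈⟨ ∑-distrib-+ (λ k → a * f k) (λ k → b * g k) ⟩
    sum (λ k → a * f k) + sum (λ k → b * g k)  ≈⟨ +-cong (*-distribˡ-sum a f) (*-distribˡ-sum b g) ⟨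
    a * sum f + b * sum g                      ∎

  δ : SquareMatrix n
  δ j k = if does (j Fin.≟ k) then 1# else 0#

  δ-refl : ∀ (j : Fin n) → δ j j ≈ 1#
  δ-refl j = reflexive (≡.cong (if_then 1# else 0#) (dec-true (j Fin.≟ j) ≡.refl))

  δ-≢ : ∀ {j k : Fin n} → j ≢ k → δ j k ≈ 0#
  δ-≢ {j = j} {k} j≢k = reflexive (≡.cong (if_then 1# else 0#) (dec-false (j Fin.≟ k) j≢k))

  sum-δ : ∀ (a : Row n) k → sum (λ j → a j * δ j k) ≈ a k
  sum-δ a k = begin
    sum (λ j → a j * δ j k)  ≈⟨ sum-single k _ (λ j j≢k → trans (*-congˡ (δ-≢ j≢k)) (zeroʳ (a j))) ⟩
    a k * δ k k              ≈⟨ *-congˡ (δ-refl k) ⟩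
    a k * 1#                 ≈⟨ *-identityʳ (a k) ⟩
    a k                      ∎

  sign : ℕ → Carrier
  sign zero          = 1#
  sign (suc zero)    = - 1#
  sign (suc (suc k)) = sign k

  sign-suc : ∀ k → sign (suc k) ≈ - sign k
  sign-suc zero          = refl
  sign-suc (suc zero)    = sym (-‿involutive 1#)
  sign-suc (suc (suc k)) = sign-suc k

  sign-+ : ∀ j k → sign (j ℕ.+ k) ≈ sign j * sign k
  sign-+ zero          k = sym (*-identityˡ _)
  sign-+ (suc zero)    k = begin
    sign (suc k)    ≈⟨ sign-suc k ⟩
    - sign k        ≈⟨ -‿cong (*-identityˡ _) ⟨
    - (1# * sign k) ≈⟨ -‿distribˡ-* 1# (sign k) ⟩
    - 1# * sign k   ∎
  sign-+ (suc (suc j)) k = sign-+ j k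

  -- Of two columns, deleting the left one first shifts the position of the other by one, so
  -- exchanging the order of deletion changes the sum of the two positions by exactly one. This is
  -- the source of the alternating signs.
  sign-coPunch : ∀ (j : Fin (suc n)) c →
    sign (toℕ (punchIn j c)) * sign (toℕ (coPunch j c)) ≈ sign (suc (toℕ j)) * sign (toℕ c)
  sign-coPunch zero    zero    = refl
  sign-coPunch zero    (suc c) = begin
    sign (toℕ c) * 1#              ≈⟨ *-identityʳ _ ⟩
    sign (toℕ c)                   ≈⟨ sign-+ 1 (suc (toℕ c)) ⟩
    - 1# * sign (suc (toℕ c))      ∎
  sign-coPunch (suc j) zero    = *-comm _ _
  sign-coPunch (suc j) (suc c) = begin
    sign (suc x) * sign (suc y)              ≈⟨ *-cong (sign-+ 1 x) (sign-+ 1 y) ⟩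
    (- 1# * sign x) * (- 1# * sign y)        ≈⟨ interchange (- 1#) (sign x) (sign y) ⟩
    - 1# * (- 1# * (sign x * sign y))        ≈⟨ *-congˡ (*-congˡ (sign-coPunch j c)) ⟩
    - 1# * (- 1# * (sign (suc (toℕ j)) * sign (toℕ c)))
                                             ≈⟨ interchange (- 1#) _ _ ⟨
    (- 1# * sign (suc (toℕ j))) * (- 1# * sign (toℕ c))
                                             ≈⟨ *-cong (sign-+ 1 (suc (toℕ j))) (sign-+ 1 (toℕ c)) ⟨
    sign (toℕ j) * sign (suc (toℕ c))        ∎
    where
    x = toℕ (punchIn j c)
    y = toℕ (coPunch j c)
    interchange : ∀ e s t → (e * s) * (e * t) ≈ e * (e * (s * t))
    interchange = solve 3 (λ e s t → (e :* s) :* (e :* t) := e :* (e :* (s :* t))) refl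

  deleteAt : SquareMatrix (suc n) → Fin (suc n) → Fin (suc n) → SquareMatrix n
  deleteAt A i j r c = A (punchIn i r) (punchIn j c)

  determinant : SquareMatrix n → Carrier
  determinant {zero}  A = 1#
  determinant {suc n} A = sum λ j → sign (toℕ j) * A zero j * determinant (deleteAt A zero j)

  determinant-cong : ∀ {A B : SquareMatrix n} → (∀ r c → A r c ≈ B r c) → determinant A ≈ determinant B
  determinant-cong {zero}  A≈B = refl
  determinant-cong {suc n} A≈B = sum-cong-≋ λ j →
    *-cong (*-congˡ {sign (toℕ j)} (A≈B zero j)) (determinant-cong λ r c → A≈B (suc r) (punchIn j c))

  ≔-congʳ : ∀ (A : Vector (Row n) m) r {u v : Row n} → (∀ c → u c ≈ v c) →
    ∀ l c → (A [ r ≔ u ]) l c ≈ (A [ r ≔ v ]) l c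
  ≔-congʳ A r {u} {v} u≈v l c with l Fin.≟ r
  ... | yes ≡.refl rewrite updateAt-updates l {f = λ _ → u} A | updateAt-updates l {f = λ _ → v} A = u≈v c
  ... | no  l≢r rewrite updateAt-minimal l r {f = λ _ → u} A l≢r | updateAt-minimal l r {f = λ _ → v} A l≢r = refl

  determinant-≔-cong : ∀ (A : SquareMatrix n) r {u v : Row n} → (∀ c → u c ≈ v c) →
    determinant (A [ r ≔ u ]) ≈ determinant (A [ r ≔ v ])
  determinant-≔-cong A r u≈v = determinant-cong (≔-congʳ A r u≈v)

  determinant-≔-id : ∀ (A : SquareMatrix n) r {u : Row n} → (∀ c → A r c ≈ u c) →
    determinant (A [ r ≔ u ]) ≈ determinant A
  determinant-≔-id A r A≈u = determinant-cong
    (≔-elim (λ l (x : Row _) → ∀ c → x c ≈ A l c) {A} {r} (sym ∘ A≈u) (λ _ _ _ → refl))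

  deleteAt-≔ : ∀ (A : SquareMatrix (suc n)) r v j l c →
    deleteAt (A [ suc r ≔ v ]) zero j l c ≈ (deleteAt A zero j [ r ≔ v ∘ punchIn j ]) l c
  deleteAt-≔ A r v j l c =
    reflexive (≡.cong (λ u → u c) (map-updateAt-local {f = _∘ punchIn j} (A ∘ suc) r ≡.refl l))

  -- With both coefficients in one statement, a zero row (0, 0), the addition of a row (1, 1) and
  -- the peeling of one summand from a sum (a, 1) are all instances.
  determinant-linear : ∀ (A : SquareMatrix n) r a b (u v : Row n) →
    determinant (A [ r ≔ (λ c → a * u c + b * v c) ])
      ≈ a * determinant (A [ r ≔ u ]) + b * determinant (A [ r ≔ v ])
  determinant-linear {suc n} A zero a b u v = begin
    sum (λ j → sign (toℕ j) * (a * u j + b * v j) * d j)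
      ≈⟨ sum-cong-≋ (λ j → expand (sign (toℕ j)) a b (u j) (v j) (d j)) ⟩
    sum (λ j → a * (sign (toℕ j) * u j * d j) + b * (sign (toℕ j) * v j * d j))
      ≈⟨ sum-linear a b (λ j → sign (toℕ j) * u j * d j) (λ j → sign (toℕ j) * v j * d j) ⟩
    a * determinant (A [ zero ≔ u ]) + b * determinant (A [ zero ≔ v ]) ∎
    where
    d : Row (suc n)
    d j = determinant (deleteAt A zero j)
    expand : ∀ s a b x y d → s * (a * x + b * y) * d ≈ a * (s * x * d) + b * (s * y * d)
    expand = solve 6 (λ s a b x y d → s :* (a :* x :+ b :* y) :* d := a :* (s :* x :* d) :+ b :* (s :* y :* d)) refl
  determinant-linear {suc n} A (suc r) a b u v = begin
    sum (λ j → sign (toℕ j) * A zero j * d (λ c → a * u c + b * v c) j)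
      ≈⟨ sum-cong-≋ (λ j → *-congˡ {sign (toℕ j) * A zero j} (d-linear j)) ⟩
    sum (λ j → sign (toℕ j) * A zero j * (a * d u j + b * d v j))
      ≈⟨ sum-cong-≋ (λ j → expand (sign (toℕ j) * A zero j) a b (d u j) (d v j)) ⟩
    sum (λ j → a * (sign (toℕ j) * A zero j * d u j) + b * (sign (toℕ j) * A zero j * d v j))
      ≈⟨ sum-linear a b (λ j → sign (toℕ j) * A zero j * d u j) (λ j → sign (toℕ j) * A zero j * d v j) ⟩
    a * determinant (A [ suc r ≔ u ]) + b * determinant (A [ suc r ≔ v ]) ∎
    where
    d : Row (suc n) → Row (suc n)
    d v j = determinant (deleteAt (A [ suc r ≔ v ]) zero j)
    d-linear : ∀ j → d (λ c → a * u c + b * v c) j ≈ a * d u j + b * d v j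
    d-linear j = begin
      d (λ c → a * u c + b * v c) j
        ≈⟨ determinant-cong (deleteAt-≔ A r (λ c → a * u c + b * v c) j) ⟩
      determinant (deleteAt A zero j [ r ≔ (λ c → a * u (punchIn j c) + b * v (punchIn j c)) ])
        ≈⟨ determinant-linear (deleteAt A zero j) r a b (u ∘ punchIn j) (v ∘ punchIn j) ⟩
      a * determinant (deleteAt A zero j [ r ≔ u ∘ punchIn j ])
        + b * determinant (deleteAt A zero j [ r ≔ v ∘ punchIn j ])
        ≈⟨ +-cong (*-congˡ (determinant-cong (deleteAt-≔ A r u j)))
                  (*-congˡ (determinant-cong (deleteAt-≔ A r v j))) ⟨
      a * d u j + b * d v j ∎
    expand : ∀ s a b x y → s * (a * x + b * y) ≈ a * (s * x) + b * (s * y)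
    expand = solve 5 (λ s a b x y → s :* (a :* x :+ b :* y) := a :* (s :* x) :+ b :* (s :* y)) refl

  determinant-zero-row : ∀ (A : SquareMatrix n) r {v : Row n} → (∀ c → v c ≈ 0#) →
    determinant (A [ r ≔ v ]) ≈ 0#
  determinant-zero-row A r {v} v≈0 = begin
    determinant (A [ r ≔ v ])
      ≈⟨ determinant-≔-cong A r (λ c → trans (v≈0 c) (sym (vanish (v c)))) ⟩
    determinant (A [ r ≔ (λ c → 0# * v c + 0# * v c) ])
      ≈⟨ determinant-linear A r 0# 0# v v ⟩
    0# * determinant (A [ r ≔ v ]) + 0# * determinant (A [ r ≔ v ])
      ≈⟨ vanish _ ⟩
    0# ∎
    where
    vanish : ∀ x → 0# * x + 0# * x ≈ 0#
    vanish x = trans (+-cong (zeroˡ x) (zeroˡ x)) (+-identityˡ 0#)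

  determinant-sum-row : ∀ (A : SquareMatrix n) r (a : Row m) (u : Vector (Row n) m) →
    determinant (A [ r ≔ (λ c → sum λ k → a k * u k c) ]) ≈ sum λ k → a k * determinant (A [ r ≔ u k ])
  determinant-sum-row {m = zero}  A r a u = determinant-zero-row A r λ _ → refl
  determinant-sum-row {m = suc m} A r a u = begin
    determinant (A [ r ≔ (λ c → a zero * u zero c + tail c) ])
      ≈⟨ determinant-≔-cong A r (λ c → +-congˡ (sym (*-identityˡ (tail c)))) ⟩
    determinant (A [ r ≔ (λ c → a zero * u zero c + 1# * tail c) ])
      ≈⟨ determinant-linear A r (a zero) 1# (u zero) tail ⟩
    a zero * determinant (A [ r ≔ u zero ]) + 1# * determinant (A [ r ≔ tail ])
      ≈⟨ +-congˡ (trans (*-identityˡ _) (determinant-sum-row A r (a ∘ suc) (u ∘ suc))) ⟩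
    sum (λ k → a k * determinant (A [ r ≔ u k ])) ∎
    where
    tail : Row _
    tail c = sum λ k → a (suc k) * u (suc k) c

  determinant-scale-rows : ∀ (s : Row n) (A : SquareMatrix n) →
    determinant (λ r c → s r * A r c) ≈ product s * determinant A
  determinant-scale-rows {zero}  s A = sym (*-identityˡ 1#)
  determinant-scale-rows {suc n} s A = begin
    sum (λ j → sign (toℕ j) * (s zero * A zero j) * determinant (λ r c → s (suc r) * deleteAt A zero j r c))
      ≈⟨ sum-cong-≋ (λ j → *-congˡ {sign (toℕ j) * (s zero * A zero j)} (determinant-scale-rows (s ∘ suc) (deleteAt A zero j))) ⟩
    sum (λ j → sign (toℕ j) * (s zero * A zero j) * (product (s ∘ suc) * d j))
      ≈⟨ sum-cong-≋ (λ j → regroup (sign (toℕ j)) (s zero) (A zero j) (product (s ∘ suc)) (d j)) ⟩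
    sum (λ j → product s * (sign (toℕ j) * A zero j * d j))
      ≈⟨ *-distribˡ-sum (product s) (λ j → sign (toℕ j) * A zero j * d j) ⟨
    product s * determinant A ∎
    where
    d : Row (suc n)
    d j = determinant (deleteAt A zero j)
    regroup : ∀ e s a t d → e * (s * a) * (t * d) ≈ s * t * (e * a * d)
    regroup = solve 5 (λ e s a t d → e :* (s :* a) :* (t :* d) := s :* t :* (e :* a :* d)) refl

  determinant-δ : determinant (δ {n}) ≈ 1#
  determinant-δ {zero}  = refl
  determinant-δ {suc n} = begin
    determinant (δ {suc n})                ≈⟨ sum-single zero (λ j → sign (toℕ j) * δ zero j * determinant (deleteAt δ zero j)) off-diagonal ⟩
    1# * 1# * determinant (δ {n})          ≈⟨ *-cong (*-identityˡ 1#) (determinant-δ {n}) ⟩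
    1# * 1#                                ≈⟨ *-identityˡ 1# ⟩
    1#                                     ∎
    where
    off-diagonal : ∀ (k : Fin (suc n)) → k ≢ zero → sign (toℕ k) * δ zero k * determinant (deleteAt δ zero k) ≈ 0#
    off-diagonal zero    k≢0 = contradiction ≡.refl k≢0
    off-diagonal (suc k) _   = trans (*-congʳ (zeroʳ _)) (zeroˡ _)

  -- Cofactors and expansion along an arbitrary row

  cofactorAt : SquareMatrix (suc n) → Fin (suc n) → Fin (suc n) → Carrier
  cofactorAt A i j = sign (toℕ i ℕ.+ toℕ j) * determinant (deleteAt A i j)

  -- Induction on `i`, expanding along the first row. Deleting column `j` leaves a zero row;
  -- deleting column `punchIn j c` leaves the unit row at `coPunch j c`, to which the induction
  -- hypothesis applies. The double minors match by `punchIn-swap` and the signs by `sign-coPunch`.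
  determinant-unit-row : ∀ (A : SquareMatrix (suc n)) i j → determinant (A [ i ≔ δ j ]) ≈ cofactorAt A i j
  determinant-unit-row A zero j = begin
    determinant (A [ zero ≔ δ j ])
      ≈⟨ sum-single j (λ k → sign (toℕ k) * δ j k * determinant (deleteAt A zero k))
           (λ k k≢j → trans (*-congʳ (trans (*-congˡ (δ-≢ (k≢j ∘ ≡.sym))) (zeroʳ _))) (zeroˡ _)) ⟩
    sign (toℕ j) * δ j j * determinant (deleteAt A zero j)
      ≈⟨ *-congʳ (trans (*-congˡ (δ-refl j)) (*-identityʳ _)) ⟩
    cofactorAt A zero j ∎
  determinant-unit-row {suc n} A (suc i) j = begin
    sum term
      ≈⟨ sum-remove {i = j} term ⟩
    term j + sum (term ∘ punchIn j)
      ≈⟨ +-cong (trans (*-congˡ term-j) (zeroʳ _)) (sum-cong-≋ other-terms) ⟩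
    0# + sum (λ c → sign (suc (toℕ i) ℕ.+ toℕ j) * (sign (toℕ c) * A zero (punchIn j c) * e c))
      ≈⟨ trans (+-identityˡ _) (sym (*-distribˡ-sum _ (λ c → sign (toℕ c) * A zero (punchIn j c) * e c))) ⟩
    cofactorAt A (suc i) j ∎
    where
    d : Row (suc (suc n))
    d k = determinant (deleteAt (A [ suc i ≔ δ j ]) zero k)
    term : Row (suc (suc n))
    term k = sign (toℕ k) * A zero k * d k
    e : Row (suc n)
    e c = determinant (deleteAt (deleteAt A (suc i) j) zero c)
    term-j : d j ≈ 0#
    term-j = trans (determinant-cong (deleteAt-≔ A i (δ j) j))
      (determinant-zero-row (deleteAt A zero j) i (λ c → δ-≢ (punchInᵢ≢i j c ∘ ≡.sym)))
    δ-punchIn : ∀ (c x : Fin (suc n)) → δ j (punchIn (punchIn j c) x) ≈ δ (coPunch j c) x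
    δ-punchIn c x with coPunch j c Fin.≟ x
    ... | yes ≡.refl = trans (reflexive (≡.cong (δ j) (punchIn-coPunch j c))) (δ-refl j)
    ... | no  c≢x    = δ-≢ λ eq → c≢x
      (punchIn-injective (punchIn j c) _ _ (≡.trans (punchIn-coPunch j c) eq))
    d-punchIn : ∀ c → d (punchIn j c) ≈ sign (toℕ i ℕ.+ toℕ (coPunch j c)) * e c
    d-punchIn c = begin
      d k
        ≈⟨ determinant-cong (deleteAt-≔ A i (δ j) k) ⟩
      determinant (deleteAt A zero k [ i ≔ δ j ∘ punchIn k ])
        ≈⟨ determinant-≔-cong (deleteAt A zero k) i (δ-punchIn c) ⟩
      determinant (deleteAt A zero k [ i ≔ δ (coPunch j c) ])
        ≈⟨ determinant-unit-row (deleteAt A zero k) i (coPunch j c) ⟩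
      cofactorAt (deleteAt A zero k) i (coPunch j c)
        ≈⟨ *-congˡ (determinant-cong λ r x → reflexive (≡.cong (A (suc (punchIn i r))) (punchIn-swap j c x))) ⟩
      sign (toℕ i ℕ.+ toℕ (coPunch j c)) * e c ∎
      where k = punchIn j c
    other-terms : ∀ c → term (punchIn j c) ≈ sign (suc (toℕ i) ℕ.+ toℕ j) * (sign (toℕ c) * A zero (punchIn j c) * e c)
    other-terms c = begin
      sign k * a * d (punchIn j c)
        ≈⟨ *-congˡ (trans (d-punchIn c) (*-congʳ (sign-+ (toℕ i) k′))) ⟩
      sign k * a * (sign (toℕ i) * sign k′ * e c)
        ≈⟨ swap₁ (sign k) a (sign (toℕ i)) (sign k′) (e c) ⟩
      sign (toℕ i) * (sign k * sign k′) * (a * e c)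
        ≈⟨ *-congʳ (*-congˡ (sign-coPunch j c)) ⟩
      sign (toℕ i) * (sign (suc (toℕ j)) * sign (toℕ c)) * (a * e c)
        ≈⟨ swap₂ (sign (toℕ i)) (sign (suc (toℕ j))) (sign (toℕ c)) a (e c) ⟩
      sign (toℕ i) * sign (suc (toℕ j)) * (sign (toℕ c) * a * e c)
        ≈⟨ *-congʳ (sign-+ (toℕ i) (suc (toℕ j))) ⟨
      sign (toℕ i ℕ.+ suc (toℕ j)) * (sign (toℕ c) * a * e c)
        ≈⟨ *-congʳ (reflexive (≡.cong sign (ℕ.+-suc (toℕ i) (toℕ j)))) ⟩
      sign (suc (toℕ i) ℕ.+ toℕ j) * (sign (toℕ c) * a * e c) ∎
      where
      k = toℕ (punchIn j c)
      k′ = toℕ (coPunch j c)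
      a = A zero (punchIn j c)
      swap₁ : ∀ x a s y e → x * a * (s * y * e) ≈ s * (x * y) * (a * e)
      swap₁ = solve 5 (λ x a s y e → x :* a :* (s :* y :* e) := s :* (x :* y) :* (a :* e)) refl
      swap₂ : ∀ s t c a e → s * (t * c) * (a * e) ≈ s * t * (c * a * e)
      swap₂ = solve 5 (λ s t c a e → s :* (t :* c) :* (a :* e) := s :* t :* (c :* a :* e)) refl

  -- Row `i` is a combination of unit rows, so multilinearity reduces the expansion along it to
  -- `determinant-unit-row`.
  laplace : ∀ (A : SquareMatrix (suc n)) i → determinant A ≈ sum λ j → A i j * cofactorAt A i j
  laplace A i = begin
    determinant A
      ≈⟨ determinant-≔-id A i (λ c → sym (sum-δ (A i) c)) ⟨
    determinant (A [ i ≔ (λ c → sum λ j → A i j * δ j c) ])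
      ≈⟨ determinant-sum-row A i (A i) δ ⟩
    sum (λ j → A i j * determinant (A [ i ≔ δ j ]))
      ≈⟨ sum-cong-≋ (λ j → *-congˡ {A i j} (determinant-unit-row A i j)) ⟩
    sum (λ j → A i j * cofactorAt A i j) ∎

  -- Alternation and row operations

  determinant-equal-rows₂ : ∀ (A : SquareMatrix 2) → (∀ c → A zero c ≈ A (suc zero) c) → determinant A ≈ 0#
  determinant-equal-rows₂ A A₀≈A₁ = begin
    1# * A zero zero * (1# * y * 1# + 0#) + (- 1# * A zero (suc zero) * (1# * x * 1# + 0#) + 0#)
      ≈⟨ +-cong (*-congʳ (*-congˡ (A₀≈A₁ zero))) (+-congʳ (*-congʳ (*-congˡ (A₀≈A₁ (suc zero))))) ⟩
    1# * x * (1# * y * 1# + 0#) + (- 1# * y * (1# * x * 1# + 0#) + 0#)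
      -- The minus one enters as a variable `e`: this is an identity of semirings, and 1 + e = 0 is
      -- used only in the next step.
      ≈⟨ solve 3 (λ x y e → con 1 :* x :* (con 1 :* y :* con 1 :+ con 0) :+ (e :* y :* (con 1 :* x :* con 1 :+ con 0) :+ con 0)
                            := (con 1 :+ e) :* (x :* y)) refl x y (- 1#) ⟩
    (1# + - 1#) * (x * y)
      ≈⟨ trans (*-congʳ (-‿inverseʳ 1#)) (zeroˡ (x * y)) ⟩
    0# ∎
    where
    x = A (suc zero) zero
    y = A (suc zero) (suc zero)

  -- Expanding along a third row reduces everything to the 2 × 2 case.
  determinant-equal-rows : ∀ (A : SquareMatrix n) {r s} → r ≢ s → (∀ c → A r c ≈ A s c) → determinant A ≈ 0#
  determinant-equal-rows {suc zero} A {zero} {zero} r≢s _ = contradiction ≡.refl r≢s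
  determinant-equal-rows {suc (suc zero)} A {zero}     {zero}     r≢s _     = contradiction ≡.refl r≢s
  determinant-equal-rows {suc (suc zero)} A {zero}     {suc zero} _   A₀≈A₁ = determinant-equal-rows₂ A A₀≈A₁
  determinant-equal-rows {suc (suc zero)} A {suc zero} {zero}     _   A₁≈A₀ = determinant-equal-rows₂ A (sym ∘ A₁≈A₀)
  determinant-equal-rows {suc (suc zero)} A {suc zero} {suc zero} r≢s _     = contradiction ≡.refl r≢s
  determinant-equal-rows {suc (suc (suc n))} A {r} {s} r≢s Ar≈As = begin
    determinant A
      ≈⟨ laplace A t ⟩
    sum (λ j → A t j * cofactorAt A t j)
      ≈⟨ sum-zero (λ j → trans (*-congˡ {A t j} (trans
           (*-congˡ {sign (toℕ t ℕ.+ toℕ j)} (determinant-equal-rows (deleteAt A t j) (r≢s ∘ punchOut-injective t≢r t≢s) (rows-equal j)))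
           (zeroʳ _))) (zeroʳ (A t j))) ⟩
    0# ∎
    where
    t = proj₁ (thirdIndex r s)
    t≢r = proj₁ (proj₂ (thirdIndex r s))
    t≢s = proj₂ (proj₂ (thirdIndex r s))
    rows-equal : ∀ j c → deleteAt A t j (punchOut t≢r) c ≈ deleteAt A t j (punchOut t≢s) c
    rows-equal j c = ≡.subst₂ (λ x y → A x (punchIn j c) ≈ A y (punchIn j c))
      (≡.sym (punchIn-punchOut t≢r)) (≡.sym (punchIn-punchOut t≢s)) (Ar≈As (punchIn j c))

  determinant-add-row : ∀ (A : SquareMatrix n) {r s} (v : Row n) → r ≢ s →
    determinant (A [ r ≔ (λ c → v c + A s c) ]) ≈ determinant (A [ r ≔ v ])
  determinant-add-row A {r} {s} v r≢s = begin
    determinant (A [ r ≔ (λ c → v c + A s c) ])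
      ≈⟨ determinant-≔-cong A r (λ c → +-cong (sym (*-identityˡ (v c))) (sym (*-identityˡ (A s c)))) ⟩
    determinant (A [ r ≔ (λ c → 1# * v c + 1# * A s c) ])
      ≈⟨ determinant-linear A r 1# 1# v (A s) ⟩
    1# * determinant (A [ r ≔ v ]) + 1# * determinant (A [ r ≔ A s ])
      ≈⟨ +-cong (*-identityˡ _) (trans (*-identityˡ _) repeated) ⟩
    determinant (A [ r ≔ v ]) + 0#
      ≈⟨ +-identityʳ _ ⟩
    determinant (A [ r ≔ v ]) ∎
    where
    repeated : determinant (A [ r ≔ A s ]) ≈ 0#
    repeated = determinant-equal-rows (A [ r ≔ A s ]) r≢s λ c → reflexive (≡.cong (λ u → u c)
      (≡.trans (updateAt-updates r A) (≡.sym (updateAt-minimal s r A (r≢s ∘ ≡.sym)))))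

-- Parent maps

iterate-+ : ∀ {a} {A : Set a} (g : A → A) x j k → iterate g x (j ℕ.+ k) ≡ iterate g (iterate g x j) k
iterate-+ g x zero    k = ≡.refl
iterate-+ g x (suc j) k = iterate-+ g (g x) j k

iterate-period : ∀ {a} {A : Set a} (g : A → A) x p → iterate g x p ≡ x → ∀ q → iterate g x (q ℕ.* p) ≡ x
iterate-period g x p gᵖx≡x zero    = ≡.refl
iterate-period g x p gᵖx≡x (suc q) = ≡.trans (iterate-+ g x p (q ℕ.* p))
  (≡.trans (≡.cong (λ y → iterate g y (q ℕ.* p)) gᵖx≡x) (iterate-period g x p gᵖx≡x q))

-- Two of the first n + 1 iterates coincide. The bound `j ≤ n` is what makes the n-th iterate a
-- sufficient test for reaching a fixed point.
eventually-periodic : ∀ {n} (g : Fin n → Fin n) x →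
  ∃₂ λ j p → j ≤ n × iterate g (iterate g x j) (suc p) ≡ iterate g x j
eventually-periodic {n} g x with pigeonhole (ℕ.n<1+n n) (λ k → iterate g x (toℕ k))
... | j , k , j<k , gʲx≡gᵏx with ℕ.m≤n⇒∃[o]m+o≡n j<k
... | p , 1+j+p≡k = toℕ j , p , ℕ.≤-pred (toℕ<n j) , ≡.sym (begin
  iterate g x (toℕ j)                     ≡⟨ gʲx≡gᵏx ⟩
  iterate g x (toℕ k)                     ≡⟨ ≡.cong (iterate g x) 1+j+p≡k ⟨
  iterate g x (suc (toℕ j) ℕ.+ p)         ≡⟨ ≡.cong (iterate g x) (ℕ.+-suc (toℕ j) p) ⟨
  iterate g x (toℕ j ℕ.+ suc p)           ≡⟨ iterate-+ g x (toℕ j) (suc p) ⟩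
  iterate g (iterate g x (toℕ j)) (suc p) ∎)
  where open ≡.≡-Reasoning

module FixedPoint {n} (g : Fin n → Fin n) {i : Fin n} (gi≡i : g i ≡ i) where

  iterate-fixed : ∀ k → iterate g i k ≡ i
  iterate-fixed zero    = ≡.refl
  iterate-fixed (suc k) = ≡.trans (≡.cong (λ x → iterate g x k) gi≡i) (iterate-fixed k)

  iterate-absorbed : ∀ {x j k} → iterate g x j ≡ i → j ≤ k → iterate g x k ≡ i
  iterate-absorbed {x} {j} gʲx≡i j≤k with ℕ.m≤n⇒∃[o]m+o≡n j≤k
  ... | o , ≡.refl = ≡.trans (iterate-+ g x j o)
    (≡.trans (≡.cong (λ y → iterate g y o) gʲx≡i) (iterate-fixed o))

  -- Going `m` times around the cycle takes at least `m` steps, so it ends at `i`; but it also ends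
  -- at `x`.
  no-cycle : ∀ {x} m p → iterate g x m ≡ i → x ≢ i → iterate g x (suc p) ≢ x
  no-cycle {x} m p gᵐx≡i x≢i gᵖx≡x = x≢i (≡.trans (≡.sym (iterate-period g x (suc p) gᵖx≡x m))
    (iterate-absorbed gᵐx≡i (ℕ.m≤m*n m (suc p))))

  -- The orbit becomes periodic within n steps, and by `no-cycle` an orbit that reaches `i` can only
  -- be periodic at `i` itself.
  reaches-within-n : ∀ {x} m → iterate g x m ≡ i → iterate g x n ≡ i
  reaches-within-n {x} m gᵐx≡i with eventually-periodic g x
  ... | j , p , j≤n , periodic with iterate g x j Fin.≟ i
  ... | yes gʲx≡i = iterate-absorbed gʲx≡i j≤n
  ... | no  gʲx≢i = contradiction periodic (no-cycle m p
    (≡.trans (≡.sym (iterate-+ g x j m)) (iterate-absorbed gᵐx≡i (ℕ.m≤n+m m j))) gʲx≢i)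

-- Determinants whose rows are edges of a parent map

module ParentMatrix {c ℓ} (R : CommutativeRing c ℓ) {n} (v : Fin n → Fin n → CommutativeRing.Carrier R)
  (g : Fin n → Fin n) {i : Fin n} (gi≡i : g i ≡ i) where

  open CommutativeRing R hiding (zero)
  open Determinant R
  open FixedPoint g gi≡i
  open import Algebra.Properties.Group +-group using (//-rightDividesˡ)
  open import Relation.Binary.Reasoning.Setoid setoid

  edge : Fin n → Fin n → Row n
  edge x y c = v x c - v y c

  telescope : ∀ x y z c → edge x y c + edge y z c ≈ edge x z c
  telescope x y z c = begin
    (v x c - v y c) + (v y c - v z c)    ≈⟨ +-assoc _ _ _ ⟩
    v x c + (- v y c + (v y c - v z c))  ≈⟨ +-congˡ (+-assoc _ _ _) ⟨
    v x c + ((- v y c + v y c) - v z c)  ≈⟨ +-congˡ (+-congʳ (-‿inverseˡ (v y c))) ⟩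
    v x c + (0# - v z c)                 ≈⟨ +-congˡ (+-identityˡ _) ⟩
    v x c - v z c                        ∎

  edge+target : ∀ x y c → edge x y c + v y c ≈ v x c
  edge+target x y c = //-rightDividesˡ (v y c) (v x c)

  module _ (A : SquareMatrix n) (A≈edge : ∀ l → l ≢ i → ∀ c → A l c ≈ edge l (g l) c) where

    -- The rows along a cycle of g telescope to zero.
    determinant-cycle : ∀ {z} → z ≢ i → ∀ m x → iterate g x m ≡ z → determinant (A [ z ≔ edge z x ]) ≈ 0#
    determinant-cycle {z} z≢i m x gᵐx≡z with x Fin.≟ z
    ... | yes ≡.refl = determinant-zero-row A z λ c → -‿inverseʳ (v z c)
    determinant-cycle z≢i zero    x gᵐx≡z | no x≢z = contradiction gᵐx≡z x≢z
    determinant-cycle {z} z≢i (suc m) x gᵐx≡z | no x≢z = begin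
      determinant (A [ z ≔ edge z x ])
        ≈⟨ determinant-add-row A (edge z x) (x≢z ∘ ≡.sym) ⟨
      determinant (A [ z ≔ (λ c → edge z x c + A x c) ])
        ≈⟨ determinant-≔-cong A z (λ c → trans (+-congˡ (A≈edge x x≢i c)) (telescope z x (g x) c)) ⟩
      determinant (A [ z ≔ edge z (g x) ])
        ≈⟨ determinant-cycle z≢i m (g x) gᵐx≡z ⟩
      0# ∎
      where
      x≢i : x ≢ i
      x≢i ≡.refl = z≢i (≡.trans (≡.sym gᵐx≡z) (iterate-fixed (suc m)))

    -- The periodic point `z` of the orbit is found within n steps, so it is not `i`, which would
    -- have absorbed the orbit by step n. Row `z` is `edge z (g z)`, and `g z` leads back to `z`.
    determinant-unrooted : ∀ {x} → iterate g x n ≢ i → determinant A ≈ 0#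
    determinant-unrooted {x} gⁿx≢i with eventually-periodic g x
    ... | j , p , j≤n , periodic = trans (sym (determinant-≔-id A z (A≈edge z z≢i)))
      (determinant-cycle z≢i p (g z) periodic)
      where
      z = iterate g x j
      z≢i : z ≢ i
      z≢i z≡i = gⁿx≢i (iterate-absorbed z≡i j≤n)

    -- Adding row `x`, which is v_x - v_(g x), to a root row v_(g x) gives v_x. So the vertex in row
    -- `i` may be moved along `g` without changing the determinant, until it is the root.
    determinant-root-row : ∀ m x → iterate g x m ≡ i → determinant (A [ i ≔ v x ]) ≈ determinant (A [ i ≔ v i ])
    determinant-root-row m x gᵐx≡i with x Fin.≟ i
    ... | yes ≡.refl = refl
    determinant-root-row zero    x gᵐx≡i | no x≢i = contradiction gᵐx≡i x≢i
    determinant-root-row (suc m) x gᵐx≡i | no x≢i = begin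
      determinant (A [ i ≔ v x ])
        ≈⟨ determinant-≔-cong A i (λ c → trans (+-congˡ (A≈edge x x≢i c)) (trans (+-comm _ _) (edge+target x (g x) c))) ⟨
      determinant (A [ i ≔ (λ c → v (g x) c + A x c) ])
        ≈⟨ determinant-add-row A (v (g x)) (x≢i ∘ ≡.sym) ⟩
      determinant (A [ i ≔ v (g x) ])
        ≈⟨ determinant-root-row m (g x) gᵐx≡i ⟩
      determinant (A [ i ≔ v i ]) ∎

  -- The invariant of the elimination. Rows are cleared by index and not by depth in the tree, so at
  -- any time the parent of a vertex may or may not have been cleared. Row `i` can only be of the
  -- second kind.
  EdgeOrVertex : Fin n → Row n → Set ℓ
  EdgeOrVertex l u = (l ≢ i × ∀ c → u c ≈ edge l (g l) c) ⊎ (∀ c → u c ≈ v l c)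

  module _ (rooted : ∀ x → iterate g x n ≡ i) where

    PartlyCleared : SquareMatrix n → Set ℓ
    PartlyCleared A = ∀ l → EdgeOrVertex l (A l)

    -- The edge from `l` to its ancestor `x` is stretched upwards: adding row `x` either finishes
    -- with v_l, if row `x` is cleared, or moves the far end to `g x`. This stops at the latest at
    -- the root, and `x` never equals `l`, since a rooted `g` has no cycle away from `i`.
    clear-row : ∀ A → PartlyCleared A → ∀ {l} → l ≢ i → ∀ m k → iterate g (iterate g l (suc k)) m ≡ i →
      determinant (A [ l ≔ edge l (iterate g l (suc k)) ]) ≈ determinant (A [ l ≔ v l ])
    clear-row A cleared {l} l≢i m k gᵐx≡i = go (cleared x) m gᵐx≡i
      where
      x = iterate g l (suc k)
      l≢x : l ≢ x
      l≢x l≡x = no-cycle n k (rooted l) l≢i (≡.sym l≡x)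
      go : _ → ∀ m → iterate g x m ≡ i → determinant (A [ l ≔ edge l x ]) ≈ determinant (A [ l ≔ v l ])
      go (inj₂ Ax≈vx) _ _ = begin
        determinant (A [ l ≔ edge l x ])
          ≈⟨ determinant-add-row A (edge l x) l≢x ⟨
        determinant (A [ l ≔ (λ c → edge l x c + A x c) ])
          ≈⟨ determinant-≔-cong A l (λ c → trans (+-congˡ (Ax≈vx c)) (edge+target l x c)) ⟩
        determinant (A [ l ≔ v l ]) ∎
      go (inj₁ (x≢i , _))      zero    x≡i   = contradiction x≡i x≢i
      go (inj₁ (x≢i , Ax≈edge)) (suc m) gᵐx≡i = begin
        determinant (A [ l ≔ edge l x ])
          ≈⟨ determinant-add-row A (edge l x) l≢x ⟨
        determinant (A [ l ≔ (λ c → edge l x c + A x c) ])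
          ≈⟨ determinant-≔-cong A l (λ c → trans (+-congˡ (Ax≈edge c)) (telescope l x (g x) c)) ⟩
        determinant (A [ l ≔ edge l (g x) ])
          ≡⟨ ≡.cong (λ y → determinant (A [ l ≔ edge l y ])) gx≡ ⟩
        determinant (A [ l ≔ edge l (iterate g l (suc (suc k))) ])
          ≈⟨ clear-row A cleared l≢i m (suc k) (≡.trans (≡.cong (λ y → iterate g y m) (≡.sym gx≡)) gᵐx≡i) ⟩
        determinant (A [ l ≔ v l ]) ∎
        where
        gx≡ : g x ≡ iterate g l (suc (suc k))
        gx≡ = ≡.trans (≡.sym (iterate-+ g l (suc k) 1)) (≡.cong (iterate g l) (ℕ.+-comm (suc k) 1))

    -- `k` bounds the indices of the rows still to be treated; each step replaces row `k` of the
    -- invariant by its vertex row, and at zero the matrix is `v`.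
    determinant-partly-cleared : ∀ k A → PartlyCleared A → (∀ l → k ≤ toℕ l → ∀ c → A l c ≈ v l c) →
      determinant A ≈ determinant v
    determinant-partly-cleared zero    A _ A≈v = determinant-cong λ l → A≈v l z≤n
    determinant-partly-cleared (suc k) A cleared A≈v with k ℕ.<? n
    ... | no  k≮n = determinant-partly-cleared k A cleared λ l k≤l →
      contradiction (ℕ.≤-<-trans k≤l (toℕ<n l)) k≮n
    ... | yes k<n = trans (sym A≈A[r]) (determinant-partly-cleared k (A [ r ≔ v r ])
        (≔-elim EdgeOrVertex {A} {r} (inj₂ λ _ → refl) (λ l _ → cleared l))
        (≔-elim (λ l (u : Row n) → k ≤ toℕ l → ∀ c → u c ≈ v l c) {A} {r} (λ _ _ → refl)
          λ l l≢r k≤l → A≈v l (ℕ.≤∧≢⇒< k≤l λ k≡l → l≢r (toℕ-injective (≡.trans (≡.sym k≡l) (≡.sym (toℕ-fromℕ< k<n)))))))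
      where
      r = fromℕ< k<n
      A≈A[r] : determinant (A [ r ≔ v r ]) ≈ determinant A
      A≈A[r] with cleared r
      ... | inj₂ Ar≈vr = determinant-≔-id A r Ar≈vr
      ... | inj₁ (r≢i , Ar≈edge) = trans
        (sym (clear-row A cleared r≢i n 0 (rooted (g r))))
        (determinant-≔-id A r Ar≈edge)

  determinant-rooted : (∀ x → iterate g x n ≡ i) → ∀ (A : SquareMatrix n) j →
    (∀ l → l ≢ i → ∀ c → A l c ≈ edge l (g l) c) → (∀ c → A i c ≈ v j c) → determinant A ≈ determinant v
  determinant-rooted rooted A j A≈edge Ai≈vj = begin
    determinant A
      ≈⟨ determinant-≔-id A i Ai≈vj ⟨
    determinant (A [ i ≔ v j ])
      ≈⟨ determinant-root-row A A≈edge n j (rooted j) ⟩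
    determinant (A [ i ≔ v i ])
      ≈⟨ determinant-partly-cleared rooted n (A [ i ≔ v i ])
           (≔-elim EdgeOrVertex {A} {i} (inj₂ λ _ → refl) (λ l l≢i → inj₁ (l≢i , A≈edge l l≢i)))
           (λ l n≤l → contradiction (toℕ<n l) (ℕ.≤⇒≯ n≤l)) ⟩
    determinant v ∎

-- Arborescences as vectors of parents

vectors : ∀ m k → List (Vec (Fin m) k)
vectors m zero    = [] ∷ []
vectors m (suc k) = cartesianProductWith _∷_ (allFin m) (vectors m k)

-- A spanning tree oriented towards `i`, with the root as its own parent. This makes the parent map
-- total, and testing the n-th iterate keeps the property decidable.
record IsArborescence {n} (w : Fin n → Fin n → Bool) (i : Fin n) (g : Vec (Fin n) n) : Set where
  field
    root     : lookup g i ≡ i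
    adjacent : ∀ l → l ≢ i → w l (lookup g l) ≡ true
    rooted   : ∀ l → iterate (lookup g) l n ≡ i

isArborescence? : ∀ {n} (w : Fin n → Fin n → Bool) i → Decidable (IsArborescence w i)
isArborescence? {n} w i g = map′
  (λ { (r , a , t) → record { root = r ; adjacent = a ; rooted = t } })
  (λ a → let open IsArborescence a in root , adjacent , rooted)
  (lookup g i Fin.≟ i
    ×-dec all? (λ l → ¬? (l Fin.≟ i) →-dec (w l (lookup g l) Bool.≟ true))
    ×-dec all? (λ l → iterate (lookup g) l n Fin.≟ i))

arborescences : ∀ {n} (w : Fin n → Fin n → Bool) (i : Fin n) → List (Vec (Fin n) n)
arborescences {n} w i = filter (isArborescence? w i) (vectors n n)

-- Multilinear expansion and the matrix-tree identity

module Expansion {c ℓ} (R : CommutativeRing c ℓ) where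

  open CommutativeRing R hiding (zero)
  open Determinant R
  open import Algebra.Definitions.RawMonoid +-rawMonoid using () renaming (_×_ to _×′_)
  open import Algebra.Properties.Semiring.Sum semiring using (sum; sum-cong-≋; ∑-distrib-+; *-distribʳ-sum)
  open import Algebra.Properties.Monoid.Mult +-monoid using (×-congʳ)
  open import Algebra.Properties.Ring ring using (-‿distribˡ-*; -‿distribʳ-*)
  open import Relation.Binary.Reasoning.Setoid setoid

  listSum : ∀ {a} {X : Set a} → (X → Carrier) → List X → Carrier
  listSum f []       = 0#
  listSum f (x ∷ xs) = f x + listSum f xs

  listSum-cong : ∀ {a} {X : Set a} {f g : X → Carrier} → (∀ x → f x ≈ g x) → ∀ xs → listSum f xs ≈ listSum g xs
  listSum-cong f≈g []       = refl
  listSum-cong f≈g (x ∷ xs) = +-cong (f≈g x) (listSum-cong f≈g xs)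

  listSum-++ : ∀ {a} {X : Set a} (f : X → Carrier) xs ys → listSum f (xs ++ ys) ≈ listSum f xs + listSum f ys
  listSum-++ f []       ys = sym (+-identityˡ _)
  listSum-++ f (x ∷ xs) ys = trans (+-congˡ (listSum-++ f xs ys)) (sym (+-assoc _ _ _))

  listSum-map : ∀ {a b} {X : Set a} {Y : Set b} (f : Y → Carrier) (h : X → Y) xs →
    listSum f (map h xs) ≈ listSum (f ∘ h) xs
  listSum-map f h []       = refl
  listSum-map f h (x ∷ xs) = +-congˡ (listSum-map f h xs)

  listSum-scale : ∀ {a} {X : Set a} x (f : X → Carrier) xs → x * listSum f xs ≈ listSum (λ y → x * f y) xs
  listSum-scale x f []       = zeroʳ x
  listSum-scale x f (y ∷ ys) = trans (distribˡ _ _ _) (+-congˡ (listSum-scale x f ys))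

  listSum-tabulate-product : ∀ {a b d} {X : Set a} {Y : Set b} {Z : Set d} {m}
    (f : Z → Carrier) (_∙_ : X → Y → Z) (h : Fin m → X) ys →
    listSum f (cartesianProductWith _∙_ (tabulate h) ys) ≈ sum λ x → listSum (λ y → f (h x ∙ y)) ys
  listSum-tabulate-product {m = zero}  f _∙_ h ys = refl
  listSum-tabulate-product {m = suc m} f _∙_ h ys = begin
    listSum f (map (h zero ∙_) ys ++ cartesianProductWith _∙_ (tabulate (h ∘ suc)) ys)
      ≈⟨ listSum-++ f (map (h zero ∙_) ys) _ ⟩
    listSum f (map (h zero ∙_) ys) + listSum f (cartesianProductWith _∙_ (tabulate (h ∘ suc)) ys)
      ≈⟨ +-cong (listSum-map f (h zero ∙_) ys) (listSum-tabulate-product f _∙_ (h ∘ suc) ys) ⟩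
    sum (λ x → listSum (λ y → f (h x ∙ y)) ys) ∎

  listSum-filter : ∀ {a p} {X : Set a} {P : Pred X p} (P? : Decidable P) x xs →
    listSum (λ y → if does (P? y) then x else 0#) xs ≈ length (filter P? xs) ×′ x
  listSum-filter P? x []       = refl
  listSum-filter P? x (y ∷ ys) with does (P? y)
  ... | true  = +-congˡ (listSum-filter P? x ys)
  ... | false = trans (+-identityˡ _) (listSum-filter P? x ys)

  -- The number `k` of rows is independent of their length `n`: once some rows of a determinant are
  -- frozen, what remains is a multilinear function of fewer rows and no longer a determinant.
  record Multilinear {n k} (F : Vector (Row n) k → Carrier) : Set (c Level.⊔ ℓ) where
    field
      F-cong    : ∀ {A B} → (∀ l c → A l c ≈ B l c) → F A ≈ F B
      F-sum-row : ∀ A r {m} (a : Row m) (u : Vector (Row n) m) →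
        F (A [ r ≔ (λ c → sum λ x → a x * u x c) ]) ≈ sum λ x → a x * F (A [ r ≔ u x ])

  determinant-multilinear : ∀ {n} → Multilinear (determinant {n})
  determinant-multilinear = record { F-cong = determinant-cong ; F-sum-row = λ A r → determinant-sum-row A r }

  infixr 5 _◂_
  _◂_ : ∀ {n k} → Row n → Vector (Row n) k → Vector (Row n) (suc k)
  (u ◂ A) zero    = u
  (u ◂ A) (suc l) = A l

  fix-first-row : ∀ {n k} {F : Vector (Row n) (suc k) → Carrier} → Multilinear F → ∀ u → Multilinear (λ A → F (u ◂ A))
  fix-first-row {F = F} F-multi u = record
    { F-cong    = λ A≈B → F-cong λ { zero c → refl ; (suc l) c → A≈B l c }
    ; F-sum-row = λ A r a us → begin
        F (u ◂ (A [ r ≔ (λ c → sum λ x → a x * us x c) ]))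
          ≈⟨ F-cong (◂-≔ A r _) ⟩
        F ((u ◂ A) [ suc r ≔ (λ c → sum λ x → a x * us x c) ])
          ≈⟨ F-sum-row (u ◂ A) (suc r) a us ⟩
        sum (λ x → a x * F ((u ◂ A) [ suc r ≔ us x ]))
          ≈⟨ sum-cong-≋ (λ x → *-congˡ {a x} (F-cong (◂-≔ A r (us x)))) ⟨
        sum (λ x → a x * F (u ◂ (A [ r ≔ us x ]))) ∎
    }
    where
    open Multilinear F-multi
    ◂-≔ : ∀ A r y l c → (u ◂ (A [ r ≔ y ])) l c ≈ ((u ◂ A) [ suc r ≔ y ]) l c
    ◂-≔ A r y zero    c = refl
    ◂-≔ A r y (suc l) c = refl

  -- The first row is expanded and frozen at each of its summands, and the remaining rows are
  -- expanded by induction.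
  multilinear-expansion : ∀ {n m k} {F : Vector (Row n) k → Carrier} → Multilinear F →
    (w : Fin k → Fin m → Carrier) (u : Fin k → Fin m → Row n) →
    F (λ l c → sum λ x → w l x * u l x c)
      ≈ listSum (λ g → product (λ l → w l (lookup g l)) * F (λ l → u l (lookup g l))) (vectors m k)
  multilinear-expansion {k = zero} F-multi w u =
    sym (trans (+-identityʳ _) (trans (*-identityˡ _) (Multilinear.F-cong F-multi λ ())))
  multilinear-expansion {m = m} {k = suc k} {F} F-multi w u = begin
    F (λ l c → sum λ x → w l x * u l x c)
      ≈⟨ F-cong (λ { zero c → refl ; (suc l) c → refl }) ⟩
    F ((rows zero ◂ rows ∘ suc) [ zero ≔ rows zero ])
      ≈⟨ F-sum-row (rows zero ◂ rows ∘ suc) zero (w zero) (u zero) ⟩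
    sum (λ x → w zero x * F ((rows zero ◂ rows ∘ suc) [ zero ≔ u zero x ]))
      ≈⟨ sum-cong-≋ (λ x → *-congˡ {w zero x} (trans
           (F-cong λ { zero c → refl ; (suc l) c → refl })
           (multilinear-expansion (fix-first-row F-multi (u zero x)) (w ∘ suc) (u ∘ suc)))) ⟩
    sum (λ x → w zero x * listSum (λ g → tail-product g * F (u zero x ◂ tail-rows g)) (vectors m k))
      ≈⟨ sum-cong-≋ (λ x → trans (listSum-scale (w zero x) _ (vectors m k)) (listSum-cong (λ g → begin
           w zero x * (tail-product g * F (u zero x ◂ tail-rows g))
             ≈⟨ *-assoc _ _ _ ⟨
           w zero x * tail-product g * F (u zero x ◂ tail-rows g)
             ≈⟨ *-congˡ (F-cong λ { zero c → refl ; (suc l) c → refl }) ⟩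
           term (x ∷ g) ∎) (vectors m k))) ⟩
    sum (λ x → listSum (λ g → term (x ∷ g)) (vectors m k))
      ≈⟨ listSum-tabulate-product term _∷_ id (vectors m k) ⟨
    listSum term (vectors m (suc k)) ∎
    where
    open Multilinear F-multi
    rows : Vector (Row _) (suc k)
    rows l c = sum λ x → w l x * u l x c
    tail-product : Vec (Fin m) k → Carrier
    tail-product g = product (λ l → w (suc l) (lookup g l))
    tail-rows : Vec (Fin m) k → Vector (Row _) k
    tail-rows g l = u (suc l) (lookup g l)
    term : Vec (Fin m) (suc k) → Carrier
    term g = product (λ l → w l (lookup g l)) * F (λ l → u l (lookup g l))

  ≈-if : ∀ {p} {P : Set p} {x y z} (P? : Dec P) → (P → x ≈ y) → (¬ P → x ≈ z) → x ≈ (if does P? then y else z)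
  ≈-if (yes p) x≈y x≈z = x≈y p
  ≈-if (no ¬p) x≈y x≈z = x≈z ¬p

  fromBool : Bool → Carrier
  fromBool b = if b then 1# else 0#

  module _ {n} (w : Fin n → Fin n → Bool) (v : SquareMatrix n) (i j : Fin n) where

    private
      edge : Fin n → Fin n → Row n
      edge x y c = v x c - v y c

      -- Weight `δ i` in row `i` kills every `g` with `g i ≢ i`, so the sum may run over all vectors
      -- while the root row, equal to v_j for every choice, is counted just once.
      weights : Fin n → Fin n → Carrier
      weights = (λ l x → fromBool (w l x)) [ i ≔ δ i ]

      rows : Fin n → Fin n → Row n
      rows = edge [ i ≔ (λ _ → v j) ]

      rows-root : ∀ x c → rows i x c ≈ v j c
      rows-root x c = reflexive (≡.cong (λ r → r x c) (updateAt-updates i edge))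

      rows-edge : ∀ {l} → l ≢ i → ∀ x c → rows l x c ≈ edge l x c
      rows-edge l≢i x c = reflexive (≡.cong (λ r → r x c) (updateAt-minimal _ i edge l≢i))

      weights-root : ∀ x → weights i x ≈ δ i x
      weights-root x = reflexive (≡.cong (λ r → r x) (updateAt-updates i (λ l x → fromBool (w l x))))

      weights-edge : ∀ {l} → l ≢ i → ∀ x → weights l x ≈ fromBool (w l x)
      weights-edge l≢i x = reflexive (≡.cong (λ r → r x) (updateAt-minimal _ i (λ l x → fromBool (w l x)) l≢i))

      term : Vec (Fin n) n → Carrier
      term g = product (λ l → weights l (lookup g l)) * determinant (λ l → rows l (lookup g l))

      fromBool-true : ∀ {b} → b ≡ true → fromBool b ≈ 1#
      fromBool-true ≡.refl = refl

      fromBool-false : ∀ {b} → b ≢ true → fromBool b ≈ 0#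
      fromBool-false {true}  b≢true = contradiction ≡.refl b≢true
      fromBool-false {false} _      = refl

      term-arborescence : ∀ {g} → IsArborescence w i g → term g ≈ determinant v
      term-arborescence {g} arb = begin
        term g              ≈⟨ *-cong (product-one weight-one) determinant-rows ⟩
        1# * determinant v  ≈⟨ *-identityˡ _ ⟩
        determinant v       ∎
        where
        open IsArborescence arb
        weight-one : ∀ l → weights l (lookup g l) ≈ 1#
        weight-one l with l Fin.≟ i
        ... | yes ≡.refl = trans (weights-root _) (trans (reflexive (≡.cong (δ i) root)) (δ-refl i))
        ... | no  l≢i    = trans (weights-edge l≢i _) (fromBool-true (adjacent l l≢i))
        determinant-rows : determinant (λ l → rows l (lookup g l)) ≈ determinant v
        determinant-rows = ParentMatrix.determinant-rooted R v (lookup g) root rooted _ j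
          (λ l l≢i → rows-edge l≢i (lookup g l)) (rows-root (lookup g i))

      -- A wrong root or a non-edge makes a weight vanish. If only rootedness fails, the weights are
      -- all one and it is the determinant that vanishes, through a cycle of `g`.
      term-other : ∀ {g} → ¬ IsArborescence w i g → term g ≈ 0#
      term-other {g} ¬arb with lookup g i Fin.≟ i
      ... | no gi≢i = trans (*-congʳ (product-zero i (trans (weights-root _) (δ-≢ (gi≢i ∘ ≡.sym))))) (zeroˡ _)
      ... | yes root with all? (λ l → ¬? (l Fin.≟ i) →-dec (w l (lookup g l) Bool.≟ true))
      ... | no ¬adjacent with ¬∀⟶∃¬ n _ (λ l → ¬? (l Fin.≟ i) →-dec (w l (lookup g l) Bool.≟ true)) ¬adjacent
      ... | l , ¬adjacent-l = trans (*-congʳ (product-zero l (trans (weights-edge l≢i _)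
              (fromBool-false λ wl≡true → ¬adjacent-l λ _ → wl≡true)))) (zeroˡ _)
        where
        l≢i : l ≢ i
        l≢i l≡i = ¬adjacent-l (contradiction l≡i)
      term-other {g} ¬arb | yes root | yes adjacent with ¬∀⟶∃¬ n _ (λ l → iterate (lookup g) l n Fin.≟ i)
              (λ rooted → ¬arb (record { root = root ; adjacent = adjacent ; rooted = rooted }))
      ... | x , gⁿx≢i = trans (*-congˡ (ParentMatrix.determinant-unrooted R v (lookup g) root _
              (λ l l≢i → rows-edge l≢i (lookup g l)) gⁿx≢i)) (zeroʳ _)

    matrix-tree : ∀ (A : SquareMatrix n) →
      (∀ l → l ≢ i → ∀ c → A l c ≈ sum λ x → fromBool (w l x) * (v l c - v x c)) →
      (∀ c → A i c ≈ v j c) → determinant A ≈ length (arborescences w i) ×′ determinant v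
    matrix-tree A A≈sum Ai≈vj = begin
      determinant A
        ≈⟨ determinant-cong expand-row ⟩
      determinant (λ l c → sum λ x → weights l x * rows l x c)
        ≈⟨ multilinear-expansion determinant-multilinear weights rows ⟩
      listSum term (vectors n n)
        ≈⟨ listSum-cong (λ g → ≈-if (isArborescence? w i g) term-arborescence term-other) (vectors n n) ⟩
      listSum (λ g → if does (isArborescence? w i g) then determinant v else 0#) (vectors n n)
        ≈⟨ listSum-filter (isArborescence? w i) (determinant v) (vectors n n) ⟩
      length (arborescences w i) ×′ determinant v ∎
      where
      expand-row : ∀ l c → A l c ≈ sum λ x → weights l x * rows l x c
      expand-row l c with l Fin.≟ i
      ... | no l≢i = trans (A≈sum l l≢i c)
        (sum-cong-≋ λ x → sym (*-cong (weights-edge l≢i x) (rows-edge l≢i x c)))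
      ... | yes ≡.refl = begin
        A i c                               ≈⟨ Ai≈vj c ⟩
        v j c                               ≈⟨ *-identityˡ _ ⟨
        1# * v j c                          ≈⟨ *-cong (δ-refl i) refl ⟨
        δ i i * v j c                       ≈⟨ sum-single i (λ x → δ i x * v j c) (λ x x≢i → trans (*-congʳ (δ-≢ (x≢i ∘ ≡.sym))) (zeroˡ _)) ⟨
        sum (λ x → δ i x * v j c)           ≈⟨ sum-cong-≋ (λ x → *-cong (weights-root x) (rows-root x c)) ⟨
        sum (λ x → weights i x * rows i x c) ∎

  -- Recognises a sum of edge vectors as a row of a gauged Laplacian: the v_l add up to the degree
  -- on the diagonal, and `δ` leaves only the term `x = c` of the v_x.
  sum-edges : ∀ {n} (b p : Row n) l c →
    sum (λ x → b x * (p l * δ l c - p x * δ x c)) ≈ sum b * (p l * δ l c) - b c * p c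
  sum-edges b p l c = begin
    sum (λ x → b x * (y - p x * δ x c))
      ≈⟨ sum-cong-≋ (λ x → trans (distribˡ (b x) y _) (+-congˡ {b x * y} (begin
           b x * - (p x * δ x c)  ≈⟨ -‿distribʳ-* (b x) (p x * δ x c) ⟨
           - (b x * (p x * δ x c)) ≈⟨ -‿cong (*-assoc (b x) (p x) (δ x c)) ⟨
           - (b x * p x * δ x c)   ≈⟨ -‿distribˡ-* (b x * p x) (δ x c) ⟩
           - (b x * p x) * δ x c   ∎))) ⟩
    sum (λ x → b x * y + - (b x * p x) * δ x c)
      ≈⟨ ∑-distrib-+ (λ x → b x * y) (λ x → - (b x * p x) * δ x c) ⟩
    sum (λ x → b x * y) + sum (λ x → - (b x * p x) * δ x c)
      ≈⟨ +-cong (sym (*-distribʳ-sum y b)) (sum-δ (λ x → - (b x * p x)) c) ⟩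
    sum b * y - b c * p c ∎
    where y = p l * δ l c

  -- Scaling turns rows `l ≢ i` into sums of edge vectors. The scalar of row `i` is `p j`, because
  -- the unit row e_j standing there has to become v_j = p_j e_j.
  gauged-matrix-tree : ∀ {n} (w : Fin (suc n) → Fin (suc n) → Bool) (p : Row (suc n)) (A : SquareMatrix (suc n)) →
    (∀ l c → p l * A l c ≈ sum (λ x → fromBool (w l x)) * (p l * δ l c) - fromBool (w l c) * p c) →
    ∀ i j → product (p [ i ≔ p j ]) * cofactorAt A i j ≈ length (arborescences w i) ×′ product p
  gauged-matrix-tree {n} w p A pA≈ i j = begin
    product s * cofactorAt A i j
      ≈⟨ *-congˡ (determinant-unit-row A i j) ⟨
    product s * determinant (A [ i ≔ δ j ])
      ≈⟨ determinant-scale-rows s (A [ i ≔ δ j ]) ⟨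
    determinant (λ l c → s l * (A [ i ≔ δ j ]) l c)
      ≈⟨ matrix-tree w v i j _ edge-rows root-row ⟩
    length (arborescences w i) ×′ determinant v
      ≈⟨ ×-congʳ (length (arborescences w i)) (trans (determinant-scale-rows p δ) (trans (*-congˡ (determinant-δ {suc n})) (*-identityʳ _))) ⟩
    length (arborescences w i) ×′ product p ∎
    where
    s = p [ i ≔ p j ]
    v : SquareMatrix (suc n)
    v x c = p x * δ x c
    root-row : ∀ c → s i * (A [ i ≔ δ j ]) i c ≈ v j c
    root-row c = *-cong (reflexive (updateAt-updates i p)) (reflexive (≡.cong (λ u → u c) (updateAt-updates i A)))
    edge-rows : ∀ l → l ≢ i → ∀ c → s l * (A [ i ≔ δ j ]) l c ≈ sum λ x → fromBool (w l x) * (v l c - v x c)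
    edge-rows l l≢i c = begin
      s l * (A [ i ≔ δ j ]) l c
        ≈⟨ *-cong (reflexive (updateAt-minimal l i p l≢i)) (reflexive (≡.cong (λ u → u c) (updateAt-minimal l i A l≢i))) ⟩
      p l * A l c
        ≈⟨ pA≈ l c ⟩
      sum (λ x → fromBool (w l x)) * (p l * δ l c) - fromBool (w l c) * p c
        ≈⟨ sum-edges (λ x → fromBool (w l x)) p l c ⟨
      sum (λ x → fromBool (w l x) * (v l c - v x c)) ∎

-- Spanning trees and arborescences

open ≡ using (refl; sym; trans; cong; cong₂; subst; module ≡-Reasoning)

lookup-extensional : ∀ {a} {A : Set a} {n} {xs ys : Vec A n} → (∀ i → lookup xs i ≡ lookup ys i) → xs ≡ ys
lookup-extensional {xs = xs} {ys} eq =
  trans (sym (tabulate∘lookup xs)) (trans (tabulate-cong eq) (tabulate∘lookup ys))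

does-true : ∀ {p} {P : Set p} (P? : Dec P) → does P? ≡ true → P
does-true (yes p) _ = p

iterate-suc : ∀ {a} {A : Set a} (g : A → A) x k → iterate g x (suc k) ≡ g (iterate g x k)
iterate-suc g x zero    = refl
iterate-suc g x (suc k) = iterate-suc g (g x) k

_++ʷ_ : ∀ {n} {E : Fin n → Fin n → Set} {x y z} → Walk E x y → Walk E y z → Walk E x z
[]      ++ʷ q = q
(e ∷ p) ++ʷ q = e ∷ (p ++ʷ q)

reverseʷ : ∀ {n} {E : Fin n → Fin n → Set} → (∀ {x y} → E x y → E y x) → ∀ {x y} → Walk E x y → Walk E y x
reverseʷ E-sym []      = []
reverseʷ E-sym (e ∷ p) = reverseʷ E-sym p ++ʷ (E-sym e ∷ [])

mapʷ : ∀ {n} {E F : Fin n → Fin n → Set} → (∀ {x y} → E x y → F x y) → ∀ {x y} → Walk E x y → Walk F x y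
mapʷ h []      = []
mapʷ h (e ∷ p) = h e ∷ mapʷ h p

-- Simple paths and cycles

PathTo : ∀ {n} → (Fin n → Fin n → Set) → Fin n → Fin n → List (Fin n) → Set
PathTo E t x []       = x ≡ t
PathTo E t x (y ∷ ys) = E x y × PathTo E t y ys

SimplePath : ∀ {n} → (Fin n → Fin n → Set) → Fin n → Fin n → Set
SimplePath E x t = ∃ λ ys → Unique (x ∷ ys) × PathTo E t x ys

module _ {n} {E : Fin n → Fin n → Set} where

  open import Data.List.Membership.DecPropositional (Fin._≟_ {n}) using (_∈?_)

  suffix : ∀ {t x y} ys → Unique (y ∷ ys) → PathTo E t y ys → x ∈ y ∷ ys → SimplePath E x t
  suffix ys       unique       path       (here refl) = ys , unique , path
  suffix (z ∷ zs) (_ ∷ unique) (_ , path) (there x∈)  = suffix zs unique path x∈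

  loop-erase : ∀ {x t} → Walk E x t → SimplePath E x t
  loop-erase []                = [] , [] ∷ [] , refl
  loop-erase {x} (_∷_ {k = y} e p) with loop-erase p
  ... | ys , unique , path with x ∈? (y ∷ ys)
  ... | yes x∈ = suffix ys unique path x∈
  ... | no  x∉ = y ∷ ys , ¬Any⇒All¬ _ x∉ ∷ unique , e , path

  close-path : ∀ {first t x} ys → PathTo E t x ys → E t first → ChainFrom E first x ys
  close-path []       refl       e = e
  close-path (y ∷ ys) (e′ , path) e = e′ , close-path ys path e

ChainFrom-map : ∀ {n} {E F : Fin n → Fin n → Set} → (∀ {x y} → E x y → F x y) →
  ∀ {first prev} vs → ChainFrom E first prev vs → ChainFrom F first prev vs
ChainFrom-map h []       e        = h e
ChainFrom-map h (v ∷ vs) (e , ch) = h e , ChainFrom-map h vs ch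

PathTo-map : ∀ {n} {E F : Fin n → Fin n → Set} → (∀ {x y} → E x y → F x y) →
  ∀ {t x} vs → PathTo E t x vs → PathTo F t x vs
PathTo-map h []       eq       = eq
PathTo-map h (v ∷ vs) (e , ch) = h e , PathTo-map h vs ch

least : ∀ {p} {P : Pred ℕ p} → Decidable P → ∀ k → P k → ∃ λ m → P m × ∀ j → P j → m ≤ j
least P? k pk with P? 0
... | yes p0 = 0 , p0 , λ _ _ → z≤n
least P? zero    pk | no ¬p0 = contradiction pk ¬p0
least P? (suc k) pk | no ¬p0 with least (P? ∘ suc) k pk
... | m , pm , smallest = suc m , pm , λ { zero p0 → contradiction p0 ¬p0 ; (suc j) pj → s≤s (smallest j pj) }

-- The undirected graph of a parent map

module ParentGraph {n} (i : Fin n) (g : Fin n → Fin n) where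

  -- The condition `x ≢ i` discards the loop of `g` at the root.
  Parent : Fin n → Fin n → Set
  Parent x y = x ≢ i × g x ≡ y

  ParentEdge : Fin n → Fin n → Set
  ParentEdge x y = Parent x y ⊎ Parent y x

  parent? : ∀ x y → Dec (Parent x y)
  parent? x y = ¬? (x Fin.≟ i) ×-dec (g x Fin.≟ y)

  parentEdge? : ∀ x y → Dec (ParentEdge x y)
  parentEdge? x y = parent? x y ⊎-dec parent? y x

  module _ (gi≡i : g i ≡ i) (rooted : ∀ x → iterate g x n ≡ i) where

    open FixedPoint g gi≡i

    acyclic-orbit : ∀ {x} p → x ≢ i → iterate g x (suc p) ≢ x
    acyclic-orbit {x} p = no-cycle n p (rooted x)

    walk-to-root : ∀ m x → iterate g x m ≡ i → Walk ParentEdge x i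
    walk-to-root zero    x refl = []
    walk-to-root (suc m) x gᵐx≡i with x Fin.≟ i
    ... | yes refl = []
    ... | no  x≢i  = inj₁ (x≢i , refl) ∷ walk-to-root m (g x) gᵐx≡i

    parentGraph-connected : Connected ParentEdge
    parentGraph-connected x y = walk-to-root n x (rooted x) ++ʷ reverseʷ swap (walk-to-root n y (rooted y))

    -- Once a simple closed walk goes from a parent to a child, it must keep descending until it closes up.
    descend : ∀ {first x y} vs → Parent y x → x ≢ first → All (x ≢_) vs → All (_≢ first) (y ∷ vs) →
      Unique (y ∷ vs) → ChainFrom ParentEdge first y vs →
      first ≢ i × g first ∈ y ∷ vs × ∃ λ m → iterate g first (suc m) ≡ y
    descend [] (_ , gy≡x) x≢first _ _ _ (inj₁ (_ , gy≡first)) =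
      contradiction (trans (sym gy≡x) gy≡first) x≢first
    descend [] _ _ _ _ _ (inj₂ (first≢i , gfirst≡y)) = first≢i , here gfirst≡y , 0 , gfirst≡y
    descend (v ∷ vs) (_ , gy≡x) _ (x≢v ∷ _) _ _ (inj₁ (_ , gy≡v) , _) =
      contradiction (trans (sym gy≡x) gy≡v) x≢v
    descend {first} {x} {y} (v ∷ vs) _ _ _ (y≢first ∷ vs≢first) ((_ ∷ y≢vs) ∷ unique) (inj₂ (v≢i , gv≡y) , chain)
      with descend vs (v≢i , gv≡y) y≢first y≢vs vs≢first unique chain
    ... | first≢i , gfirst∈ , m , gᵐfirst≡v =
      first≢i , there gfirst∈ , suc m , trans (iterate-suc g first (suc m)) (trans (cong g gᵐfirst≡v) gv≡y)

    -- As long as the walk ascends, closing up would make `first` periodic. Once it turns down,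
    -- `descend` forces it to pass through `g first`, which was left behind after the first step.
    ascent-never-closes : ∀ {first y} vs m → first ≢ i → iterate g first (suc m) ≡ y → All (g first ≢_) (y ∷ vs) →
      All (_≢ first) (y ∷ vs) → Unique (y ∷ vs) → ¬ ChainFrom ParentEdge first y vs
    ascent-never-closes {first} [] m first≢i gᵐ≡y _ _ _ (inj₁ (_ , gy≡first)) =
      acyclic-orbit (suc m) first≢i (trans (iterate-suc g first (suc m)) (trans (cong g gᵐ≡y) gy≡first))
    ascent-never-closes [] m first≢i gᵐ≡y (gfirst≢y ∷ _) _ _ (inj₂ (_ , gfirst≡y)) = gfirst≢y gfirst≡y
    ascent-never-closes {first} (v ∷ vs) m first≢i gᵐ≡y (_ ∷ gfirst≢) (_ ∷ ≢first) (_ ∷ unique) (inj₁ (_ , gy≡v) , chain) =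
      ascent-never-closes vs (suc m) first≢i (trans (iterate-suc g first (suc m)) (trans (cong g gᵐ≡y) gy≡v))
        gfirst≢ ≢first unique chain
    ascent-never-closes (v ∷ vs) m first≢i gᵐ≡y (_ ∷ gfirst≢) (y≢first ∷ ≢first) ((_ ∷ y≢vs) ∷ unique) (inj₂ v→y , chain)
      with descend vs v→y y≢first y≢vs ≢first unique chain
    ... | _ , gfirst∈ , _ = All¬⇒¬Any gfirst≢ gfirst∈

    -- After an upward first step the cycle would have to come back through `g x`, its second
    -- vertex. After a downward first step, going up returns to `x` at once, and going down forever
    -- makes `x` its own ancestor.
    parentGraph-acyclic : Acyclic ParentEdge
    parentGraph-acyclic (x ∷ y ∷ z ∷ vs) (_ , ((x≢y ∷ x≢z ∷ x≢vs) ∷ (y≢z ∷ y≢vs) ∷ unique) , inj₁ (x≢i , gx≡y) , chain) =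
      after-ascent chain
      where
      ≢x : All (_≢ x) (z ∷ vs)
      ≢x = All.map (_∘ sym) (x≢z ∷ x≢vs)
      gx≢ : All (g x ≢_) (z ∷ vs)
      gx≢ = subst (λ u → All (u ≢_) (z ∷ vs)) (sym gx≡y) (y≢z ∷ y≢vs)
      after-ascent : ¬ (ParentEdge y z × ChainFrom ParentEdge x z vs)
      after-ascent (inj₁ (_ , gy≡z) , chain) =
        ascent-never-closes vs 1 x≢i (trans (cong g gx≡y) gy≡z) gx≢ ≢x unique chain
      after-ascent (inj₂ z→y , chain) with descend vs z→y (x≢y ∘ sym) y≢vs ≢x unique chain
      ... | _ , gx∈ , _ = All¬⇒¬Any gx≢ gx∈
    parentGraph-acyclic (x ∷ y ∷ z ∷ vs) (_ , ((x≢y ∷ x≢z ∷ x≢vs) ∷ (y≢z ∷ y≢vs) ∷ unique) , inj₂ (y≢i , gy≡x) , inj₁ (_ , gy≡z) , _) =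
      x≢z (trans (sym gy≡x) gy≡z)
    parentGraph-acyclic (x ∷ y ∷ z ∷ vs) (_ , ((x≢y ∷ x≢z ∷ x≢vs) ∷ (y≢z ∷ y≢vs) ∷ unique) , inj₂ (y≢i , gy≡x) , inj₂ (z≢i , gz≡y) , chain)
      with descend vs (z≢i , gz≡y) (x≢y ∘ sym) y≢vs (All.map (_∘ sym) (x≢z ∷ x≢vs)) unique chain
    ... | x≢i , _ , m , gᵐx≡z = acyclic-orbit (suc (suc m)) x≢i
      (trans (iterate-suc g x (suc (suc m))) (trans (cong g (trans (iterate-suc g x (suc m)) (trans (cong g gᵐx≡z) gz≡y))) gy≡x))
    parentGraph-acyclic (x ∷ y ∷ []) (s≤s () , _)

module _ {n} {i : Fin n} {g h : Fin n → Fin n} where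

  private
    module G = ParentGraph i g
    module H = ParentGraph i h

  -- If h did not send x to its g-parent y, it would send y to x, and by induction so would g.
  parent-unique : g i ≡ i → h i ≡ i → (∀ x → iterate g x n ≡ i) →
    (∀ x y → G.ParentEdge x y → H.ParentEdge x y) → ∀ m x → iterate g x m ≡ i → g x ≡ h x
  parent-unique gi≡i hi≡i rooted G⊆H m x gᵐx≡i with x Fin.≟ i
  ... | yes refl = trans gi≡i (sym hi≡i)
  parent-unique gi≡i hi≡i rooted G⊆H zero    x gᵐx≡i | no x≢i = contradiction gᵐx≡i x≢i
  parent-unique gi≡i hi≡i rooted G⊆H (suc m) x gᵐx≡i | no x≢i with G⊆H x (g x) (inj₁ (x≢i , refl))
  ... | inj₁ (_ , hx≡gx) = sym hx≡gx
  ... | inj₂ (_ , hgx≡x) = contradiction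
    (trans (parent-unique gi≡i hi≡i rooted G⊆H m (g x) gᵐx≡i) hgx≡x)
    (G.acyclic-orbit gi≡i rooted 1 x≢i)

vectors-unique : ∀ m k → Unique (vectors m k)
vectors-unique m zero    = [] ∷ []
vectors-unique m (suc k) = cartesianProductWith⁺ _∷_ ∷-injective (allFin⁺ m) (vectors-unique m k)

∈-vectors : ∀ {m k} (xs : Vec (Fin m) k) → xs ∈ vectors m k
∈-vectors []       = here refl
∈-vectors (x ∷ xs) = ∈-cartesianProductWith⁺ _∷_ (∈-allFin x) (∈-vectors xs)

unique-lookup-injective : ∀ {a} {A : Set a} {xs : List A} → Unique xs → ∀ j k → List.lookup xs j ≡ List.lookup xs k → j ≡ k
unique-lookup-injective {xs = _ ∷ _} _ zero    zero    _  = refl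
unique-lookup-injective {xs = _ ∷ xs} (x∉xs ∷ _) zero    (suc k) eq = contradiction eq (All.lookup x∉xs (∈-lookup {xs = xs} k))
unique-lookup-injective {xs = _ ∷ xs} (x∉xs ∷ _) (suc j) zero    eq = contradiction (sym eq) (All.lookup x∉xs (∈-lookup {xs = xs} j))
unique-lookup-injective {xs = _ ∷ _} (_ ∷ unique) (suc j) (suc k) eq = cong suc (unique-lookup-injective unique j k eq)

-- The bijection between arborescences and spanning trees

module SpanningTrees {n} (M : MixedGraph n) (i : Fin n) where

  adjacency : Fin n → Fin n → Bool
  adjacency x y = isEdge (arc M x y)

  Adj-sym : ∀ {x y} → Adj M x y → Adj M y x
  Adj-sym {x} {y} xy = trans (cong isEdge (consistent M x y)) (trans (isEdge-rev (arc M x y)) xy)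
    where
    isEdge-rev : ∀ a → isEdge (rev a) ≡ isEdge a
    isEdge-rev none = refl
    isEdge-rev und  = refl
    isEdge-rev fwd  = refl
    isEdge-rev bwd  = refl

  Adj-irrefl : ∀ {x} → ¬ Adj M x x
  Adj-irrefl {x} xx with trans (sym xx) (cong isEdge (loopless M x))
  ... | ()

  module _ (g : Vec (Fin n) n) where

    open ParentGraph i (lookup g)

    treeOf : Vec (Vec Bool n) n
    treeOf = Vec.tabulate λ x → Vec.tabulate λ y → does (parentEdge? x y)

    lookup-treeOf : ∀ x y → lookup (lookup treeOf x) y ≡ does (parentEdge? x y)
    lookup-treeOf x y = trans (cong (λ row → lookup row y) (lookup∘tabulate _ x)) (lookup∘tabulate _ y)

    treeOf⇒edge : ∀ {x y} → SubAdj treeOf x y → ParentEdge x y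
    treeOf⇒edge {x} {y} xy = does-true (parentEdge? x y) (trans (sym (lookup-treeOf x y)) xy)

    edge⇒treeOf : ∀ {x y} → ParentEdge x y → SubAdj treeOf x y
    edge⇒treeOf {x} {y} xy = trans (lookup-treeOf x y) (dec-true (parentEdge? x y) xy)

    treeOf-spanningTree : IsArborescence adjacency i g → IsSpanningTree M treeOf
    treeOf-spanningTree arb = record
      { symmetric = λ x y → trans (lookup-treeOf x y)
          (trans (Bool.∨-comm (does (parent? x y)) (does (parent? y x))) (sym (lookup-treeOf y x)))
      ; subgraph  = λ x y → [ parent⇒Adj , Adj-sym ∘ parent⇒Adj ]′ ∘ treeOf⇒edge
      ; connected = λ x y → mapʷ edge⇒treeOf (parentGraph-connected root rooted x y)
      ; acyclic   = λ { (v ∷ vs) (2≤ , unique , chain) → parentGraph-acyclic root rooted (v ∷ vs)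
                        (2≤ , unique , ChainFrom-map treeOf⇒edge vs chain) }
      }
      where
      open IsArborescence arb
      parent⇒Adj : ∀ {x y} → Parent x y → Adj M x y
      parent⇒Adj {x} (x≢i , refl) = adjacent x x≢i

  treeOf-injective : ∀ {g h} → IsArborescence adjacency i g → IsArborescence adjacency i h → treeOf g ≡ treeOf h → g ≡ h
  treeOf-injective {g} {h} G H eq = lookup-extensional λ x →
    parent-unique (IsArborescence.root G) (IsArborescence.root H) (IsArborescence.rooted G)
      (λ x y xy → treeOf⇒edge h (subst (λ T → SubAdj T x y) eq (edge⇒treeOf g xy)))
      n x (IsArborescence.rooted G x)

  module _ {T : Vec (Vec Bool n) n} (tree : IsSpanningTree M T) where

    open IsSpanningTree tree

    -- Walks to the root with exactly `k` steps: decidable by recursion on `k`, so that a search for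
    -- the least `k` yields the distance in `T`.
    Reaches : ℕ → Fin n → Set
    Reaches zero    x = x ≡ i
    Reaches (suc k) x = ∃ λ y → SubAdj T x y × Reaches k y

    reaches? : ∀ k x → Dec (Reaches k x)
    reaches? zero    x = x Fin.≟ i
    reaches? (suc k) x = any? λ y → (lookup (lookup T x) y Bool.≟ true) ×-dec reaches? k y

    walk⇒reaches : ∀ {x} → Walk (SubAdj T) x i → ∃ λ k → Reaches k x
    walk⇒reaches []      = 0 , refl
    walk⇒reaches (e ∷ p) with walk⇒reaches p
    ... | k , r = suc k , _ , e , r

    distance : ∀ x → ∃ λ k → Reaches k x × ∀ j → Reaches j x → k ≤ j
    distance x with walk⇒reaches (connected x i)
    ... | k , r = least (λ j → reaches? j x) k r

    dist : Fin n → ℕ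
    dist x = proj₁ (distance x)

    Closer : Fin n → Fin n → Set
    Closer x y = (x ≡ i → y ≡ i) × (x ≢ i → SubAdj T x y × dist y < dist x)

    -- The parent of `x` is the second vertex of a shortest walk to the root; the rest of that walk
    -- bounds the distance of the parent.
    closer : ∀ x → ∃ (Closer x)
    closer x with distance x
    ... | zero  , x≡i , _ = i , (λ _ → refl) , contradiction x≡i
    ... | suc k , (y , xy , r) , _ with x Fin.≟ i
    ... | yes x≡i = i , (λ _ → refl) , contradiction x≡i
    ... | no  x≢i = y , (λ x≡i → contradiction x≡i x≢i) , λ _ → xy , s≤s (proj₂ (proj₂ (distance y)) k r)

    parents : Vec (Fin n) n
    parents = Vec.tabulate (proj₁ ∘ closer)

    parents-closer : ∀ x → Closer x (lookup parents x)
    parents-closer x = subst (Closer x) (sym (lookup∘tabulate (proj₁ ∘ closer) x)) (proj₂ (closer x))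

    parents-root : lookup parents i ≡ i
    parents-root = proj₁ (parents-closer i) refl

    parents-reach : ∀ k x → dist x ≤ k → iterate (lookup parents) x k ≡ i
    parents-reach zero    x dx≤0 = subst (λ k → Reaches k x) (ℕ.n≤0⇒n≡0 dx≤0) (proj₁ (proj₂ (distance x)))
    parents-reach (suc k) x dx≤k = by-cases (x Fin.≟ i)
      where
      by-cases : Dec (x ≡ i) → iterate (lookup parents) x (suc k) ≡ i
      by-cases (yes refl) = FixedPoint.iterate-fixed (lookup parents) parents-root (suc k)
      by-cases (no  x≢i)  = parents-reach k (lookup parents x)
        (ℕ.≤-pred (ℕ.<-≤-trans (proj₂ (proj₂ (parents-closer x) x≢i)) dx≤k))

    parents-arborescence : IsArborescence adjacency i parents
    parents-arborescence = record
      { root     = parents-root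
      ; adjacent = λ l l≢i → subgraph _ _ (proj₁ (proj₂ (parents-closer l) l≢i))
      ; rooted   = λ l → FixedPoint.reaches-within-n (lookup parents) parents-root (dist l)
                     (parents-reach (dist l) l ℕ.≤-refl)
      }

    open ParentGraph i (lookup parents)

    T-sym : ∀ {x y} → SubAdj T x y → SubAdj T y x
    T-sym {x} {y} xy = trans (symmetric y x) xy

    edge⇒T : ∀ {x y} → ParentEdge x y → SubAdj T x y
    edge⇒T = [ parent⇒T , T-sym ∘ parent⇒T ]′
      where
      parent⇒T : ∀ {x y} → Parent x y → SubAdj T x y
      parent⇒T {x} (x≢i , refl) = proj₁ (proj₂ (parents-closer x) x≢i)

    -- An edge of T outside the parent graph would close a simple path of the parent graph to a cycle.
    T⇒edge : ∀ {x y} → SubAdj T x y → ParentEdge x y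
    T⇒edge {x} {y} xy with parentEdge? x y
    ... | yes edge = edge
    ... | no ¬edge with loop-erase (parentGraph-connected parents-root (IsArborescence.rooted parents-arborescence) x y)
    -- Only a path of at least two steps closes up to a cycle. The empty path would make `xy` a loop
    -- of the graph, and a path of one step is itself the missing parent edge.
    ... | []           , _      , refl      = contradiction (subgraph _ _ xy) Adj-irrefl
    ... | _ ∷ []       , _      , e , refl  = contradiction e ¬edge
    ... | us@(_ ∷ _ ∷ _) , unique , path    = contradiction
      (s≤s (s≤s z≤n) , unique , close-path us (PathTo-map edge⇒T us path) (T-sym xy)) (acyclic (x ∷ us))

    treeOf-parents : treeOf parents ≡ T
    treeOf-parents = lookup-extensional λ x → lookup-extensional λ y →
      ≡true-extensional (edge⇒T ∘ treeOf⇒edge parents) (edge⇒treeOf parents ∘ T⇒edge)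
      where
      ≡true-extensional : ∀ {a b} → (a ≡ true → b ≡ true) → (b ≡ true → a ≡ true) → a ≡ b
      ≡true-extensional {false} {false} _ _ = refl
      ≡true-extensional {false} {true}  _ b⇒a = b⇒a refl
      ≡true-extensional {true}  {_}     a⇒b _ = sym (a⇒b refl)

  arborescences⤖spanningTrees : Fin (length (arborescences adjacency i)) ⤖ SpanningTree M
  arborescences⤖spanningTrees = mk⤖ {to = to} (injective , strictlySurjective⇒surjective surjective)
    where
    gs = arborescences adjacency i

    arb : ∀ k → IsArborescence adjacency i (List.lookup gs k)
    arb k = proj₂ (∈-filter⁻ (isArborescence? adjacency i) {xs = vectors n n} (∈-lookup {xs = gs} k))

    to : Fin (length gs) → SpanningTree M
    to k = spanningTree (treeOf (List.lookup gs k)) (treeOf-spanningTree _ (arb k))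

    injective : ∀ {j k} → to j ≡ to k → j ≡ k
    injective {j} {k} eq = unique-lookup-injective
      (filter⁺ (isArborescence? adjacency i) (vectors-unique n n)) j k
      (treeOf-injective (arb j) (arb k) (cong SpanningTree.edges eq))

    index : ∀ {T} → IsSpanningTree M T → ∃ λ k → treeOf (List.lookup gs k) ≡ T
    index tree = Any.index p , trans (cong treeOf (sym (lookup-index p))) (treeOf-parents tree)
      where
      p : parents tree ∈ gs
      p = ∈-filter⁺ (isArborescence? adjacency i) (∈-vectors (parents tree)) (parents-arborescence tree)

    -- Being a spanning tree is an irrelevant field, so the preimage is found by search.
    surjective : ∀ t → ∃ λ k → to k ≡ t
    surjective (spanningTree T tree) with any? (λ k → ≡-dec (≡-dec Bool._≟_) (treeOf (List.lookup gs k)) T)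
    ... | yes (k , refl) = k , refl
    ... | no  ¬found     = contradiction-irr (index tree) ¬found

-- The Eisenstein Laplacian

⊕-⊛-commutativeRing : CommutativeRing Level.0ℓ Level.0ℓ
⊕-⊛-commutativeRing = record
  { Carrier = ℤω ; _≈_ = _≡_ ; _+_ = _⊕_ ; _*_ = _⊛_ ; -_ = ⊖_ ; 0# = 0ω ; 1# = 1ω
  ; isCommutativeRing = record
    { isRing = record
      { +-isAbelianGroup = record
        { isGroup = record
          { isMonoid = record
            { isSemigroup = record
              { isMagma = record { isEquivalence = isEquivalence ; ∙-cong = cong₂ _⊕_ }
              ; assoc = λ x y z → cong₂ _+_ω (ℤ.+-assoc (re x) (re y) (re z)) (ℤ.+-assoc (im x) (im y) (im z)) }
            ; identity = (λ x → cong₂ _+_ω (ℤ.+-identityˡ (re x)) (ℤ.+-identityˡ (im x)))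
                       , (λ x → cong₂ _+_ω (ℤ.+-identityʳ (re x)) (ℤ.+-identityʳ (im x))) }
          ; inverse = (λ x → cong₂ _+_ω (ℤ.+-inverseˡ (re x)) (ℤ.+-inverseˡ (im x)))
                    , (λ x → cong₂ _+_ω (ℤ.+-inverseʳ (re x)) (ℤ.+-inverseʳ (im x)))
          ; ⁻¹-cong = cong (λ x → ⊖ x) }
        ; comm = λ x y → cong₂ _+_ω (ℤ.+-comm (re x) (re y)) (ℤ.+-comm (im x) (im y)) }
      ; *-cong = cong₂ _⊛_
      ; *-assoc = λ { (a + b ω) (c + d ω) (e + f ω) →
          cong₂ _+_ω (assoc-re a b c d e f) (assoc-im a b c d e f) }
      ; *-identity = (λ { (a + b ω) → cong₂ _+_ω (idˡ-re a b) (idˡ-im a b) })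
                   , (λ { (a + b ω) → cong₂ _+_ω (idʳ-re a b) (idʳ-im a b) })
      ; distrib = (λ { (a + b ω) (c + d ω) (e + f ω) →
                      cong₂ _+_ω (distˡ-re a b c d e f) (distˡ-im a b c d e f) })
                , (λ { (a + b ω) (c + d ω) (e + f ω) →
                      cong₂ _+_ω (distʳ-re a b c d e f) (distʳ-im a b c d e f) }) }
    ; *-comm = λ { (a + b ω) (c + d ω) → cong₂ _+_ω (comm-re a b c d) (comm-im a b c d) } } }
  where
  open import Data.Integer using (_+_; _*_; _-_)
  assoc-re : ∀ a b c d e f →
    (a * c - b * d) * e - (a * d + b * c + b * d) * f ≡ a * (c * e - d * f) - b * (c * f + d * e + d * f)
  assoc-re = solve-∀
  assoc-im : ∀ a b c d e f →
    (a * c - b * d) * f + (a * d + b * c + b * d) * e + (a * d + b * c + b * d) * f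
      ≡ a * (c * f + d * e + d * f) + b * (c * e - d * f) + b * (c * f + d * e + d * f)
  assoc-im = solve-∀
  idˡ-re : ∀ a b → + 1 * a - + 0 * b ≡ a
  idˡ-re = solve-∀
  idˡ-im : ∀ a b → + 1 * b + + 0 * a + + 0 * b ≡ b
  idˡ-im = solve-∀
  idʳ-re : ∀ a b → a * + 1 - b * + 0 ≡ a
  idʳ-re = solve-∀
  idʳ-im : ∀ a b → a * + 0 + b * + 1 + b * + 0 ≡ b
  idʳ-im = solve-∀
  distˡ-re : ∀ a b c d e f → a * (c + e) - b * (d + f) ≡ (a * c - b * d) + (a * e - b * f)
  distˡ-re = solve-∀
  distˡ-im : ∀ a b c d e f →
    a * (d + f) + b * (c + e) + b * (d + f) ≡ (a * d + b * c + b * d) + (a * f + b * e + b * f)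
  distˡ-im = solve-∀
  distʳ-re : ∀ a b c d e f → (c + e) * a - (d + f) * b ≡ (c * a - d * b) + (e * a - f * b)
  distʳ-re = solve-∀
  distʳ-im : ∀ a b c d e f →
    (c + e) * b + (d + f) * a + (d + f) * b ≡ (c * b + d * a + d * b) + (e * b + f * a + f * b)
  distʳ-im = solve-∀
  comm-re : ∀ a b c d → a * c - b * d ≡ c * a - d * b
  comm-re = solve-∀
  comm-im : ∀ a b c d → a * d + b * c + b * d ≡ c * b + d * a + d * b
  comm-im = solve-∀

open CommutativeRing ⊕-⊛-commutativeRing using (+-rawMonoid; semiring; *-identityˡ; *-identityʳ; distribˡ; distribʳ; zeroʳ)
open import Algebra.Definitions.RawMonoid +-rawMonoid using () renaming (_×_ to _×ω_)
open import Algebra.Properties.Semiring.Sum semiring using (sum; sum-cong-≋)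
open import Algebra.Properties.Ring (CommutativeRing.ring ⊕-⊛-commutativeRing) using (-‿distribʳ-*)
open Determinant ⊕-⊛-commutativeRing
open Expansion ⊕-⊛-commutativeRing

normω-⊛ : ∀ x y → normω (x ⊛ y) ≡ normω x ℤ.* normω y
normω-⊛ (a + b ω) (c + d ω) = multiplicative a b c d
  where
  open import Data.Integer using (_+_; _*_; _-_)
  multiplicative : ∀ a b c d →
    (a * c - b * d) * (a * c - b * d) + (a * c - b * d) * (a * d + b * c + b * d)
      + (a * d + b * c + b * d) * (a * d + b * c + b * d)
    ≡ (a * a + a * b + b * b) * (c * c + c * d + d * d)
  multiplicative = solve-∀

normω-fromℕω : ∀ k → normω (fromℕω k) ≡ + k ℤ.* + k
normω-fromℕω k = square (+ k)
  where
  square : ∀ a → a ℤ.* a ℤ.+ a ℤ.* + 0 ℤ.+ + 0 ℤ.* + 0 ≡ a ℤ.* a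
  square = solve-∀

×ω≡fromℕω : ∀ k x → k ×ω x ≡ fromℕω k ⊛ x
×ω≡fromℕω zero    x = sym (CommutativeRing.zeroˡ ⊕-⊛-commutativeRing x)
×ω≡fromℕω (suc k) x = begin
  x ⊕ k ×ω x                ≡⟨ cong (x ⊕_) (×ω≡fromℕω k x) ⟩
  x ⊕ fromℕω k ⊛ x          ≡⟨ cong (_⊕ fromℕω k ⊛ x) (*-identityˡ x) ⟨
  1ω ⊛ x ⊕ fromℕω k ⊛ x     ≡⟨ distribʳ x 1ω (fromℕω k) ⟨
  fromℕω (suc k) ⊛ x        ∎
  where open ≡-Reasoning

normω-product : ∀ {n} (f : Fin n → ℤω) → (∀ k → normω (f k) ≡ + 1) → normω (product f) ≡ + 1
normω-product {zero}  f unit = refl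
normω-product {suc n} f unit = trans (normω-⊛ (f zero) (product (f ∘ suc)))
  (cong₂ ℤ._*_ (unit zero) (normω-product (f ∘ suc) (unit ∘ suc)))

Σω≡sum : ∀ {n} (f : Fin n → ℤω) → Σω f ≡ sum f
Σω≡sum {zero}  f = refl
Σω≡sum {suc n} f = cong (f zero ⊕_) (Σω≡sum (f ∘ suc))

signω≡sign : ∀ k → signω k ≡ sign k
signω≡sign zero          = refl
signω≡sign (suc zero)    = refl
signω≡sign (suc (suc k)) = signω≡sign k

det≡determinant : ∀ {n} (A : Matrix n) → det A ≡ determinant A
det≡determinant {zero}  A = refl
det≡determinant {suc n} A = trans (Σω≡sum (λ j → signω (toℕ j) ⊛ A zero j ⊛ det (minor A zero j)))
  (sum-cong-≋ λ j → cong₂ _⊛_ (cong (_⊛ A zero j) (signω≡sign (toℕ j))) (det≡determinant (minor A zero j)))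

cofactor≡cofactorAt : ∀ {n} (A : Matrix (suc n)) i j → cofactor A i j ≡ cofactorAt A i j
cofactor≡cofactorAt A i j = cong₂ _⊛_ (signω≡sign (toℕ i ℕ.+ toℕ j)) (det≡determinant (minor A i j))

-- Degrees as sums

count : ∀ {m} → (Fin m → Bool) → ℕ
count {zero}  f = 0
count {suc m} f = (if f zero then 1 else 0) ℕ.+ count (f ∘ suc)

-- The counting loop of degree is local to Defs and cannot be named here: go-count leaves it as a
-- metavariable, which the use in degree-count determines.
mutual
  degree-count : ∀ {n} (M : MixedGraph n) i → degree M i ≡ count (λ j → isEdge (arc M i j))
  degree-count {suc zero} M i = refl
  degree-count {suc (suc k)} M i
    with isEdge (arc M i zero) | isEdge (arc M i (suc zero)) | (λ j → isEdge (arc M i (suc (suc j))))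
  -- Two entries have been split off, so the remaining length is `k` and the graph parameter is
  -- `suc k`. Abstracting the latter makes all arguments of the metavariable distinct variables,
  -- which determines it.
  ... | b | c | f with suc k | M | i
  ... | _ | M′ | i′ = cong (λ x → (if b then 1 else 0) ℕ.+ ((if c then 1 else 0) ℕ.+ x)) (go-count M′ i′ f)

  go-count : ∀ {n} (M : MixedGraph (suc n)) (i : Fin (suc n)) {m} (f : Fin m → Bool) → _ ≡ count f
  go-count M i {zero}  f = refl
  go-count M i {suc m} f = cong ((if f zero then 1 else 0) ℕ.+_) (go-count M i (f ∘ suc))

fromℕω-count : ∀ {m} (f : Fin m → Bool) → fromℕω (count f) ≡ sum (fromBool ∘ f)
fromℕω-count {zero}  f = refl
fromℕω-count {suc m} f = trans (split (f zero)) (cong (fromBool (f zero) ⊕_) (fromℕω-count (f ∘ suc)))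
  where
  split : ∀ b → fromℕω ((if b then 1 else 0) ℕ.+ count (f ∘ suc)) ≡ fromBool b ⊕ fromℕω (count (f ∘ suc))
  split true  = refl
  split false = refl

-- Sixth roots of unity and the gauge

ωpower : ℕ → ℤω
ωpower zero    = 1ω
ωpower (suc k) = ωpower k ⊛ ω

phase : Fin 6 → ℤω
phase k = ωpower (toℕ k)

-- The last case wraps around from the sixth part to the first and says that the sixth power of `ω`
-- is 1; this is why there are six parts.
phase-ω : ∀ k → phase k ⊛ ω ≡ phase (next6 k)
phase-ω zero                               = refl
phase-ω (suc zero)                         = refl
phase-ω (suc (suc zero))                   = refl
phase-ω (suc (suc (suc zero)))             = refl
phase-ω (suc (suc (suc (suc zero))))       = refl
phase-ω (suc (suc (suc (suc (suc zero))))) = refl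

phase-ω̄ : ∀ k → phase (next6 k) ⊛ ω̄ ≡ phase k
phase-ω̄ zero                               = refl
phase-ω̄ (suc zero)                         = refl
phase-ω̄ (suc (suc zero))                   = refl
phase-ω̄ (suc (suc (suc zero)))             = refl
phase-ω̄ (suc (suc (suc (suc zero))))       = refl
phase-ω̄ (suc (suc (suc (suc (suc zero))))) = refl

normω-phase : ∀ k → normω (phase k) ≡ + 1
normω-phase zero                               = refl
normω-phase (suc zero)                         = refl
normω-phase (suc (suc zero))                   = refl
normω-phase (suc (suc (suc zero)))             = refl
normω-phase (suc (suc (suc (suc zero))))       = refl
normω-phase (suc (suc (suc (suc (suc zero))))) = refl

module _ {n} (M : MixedGraph (suc n)) (sp : PropertySP M) where

  open ≡-Reasoning

  p : Fin (suc n) → ℤω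
  p x = phase (proj₁ sp x)

  -- Property SP enters here: along each kind of edge the label changes exactly as multiplication by
  -- the entry of `N` changes the phase. A backward arc is read as a forward arc from `c` to `l`.
  gauge-N : ∀ l c → p l ⊛ N M l c ≡ fromBool (isEdge (arc M l c)) ⊛ p c
  gauge-N l c with arc M l c in eq
  ... | none = trans (zeroʳ (p l)) (sym (CommutativeRing.zeroˡ ⊕-⊛-commutativeRing (p c)))
  ... | und  = trans (*-identityʳ (p l)) (trans (cong phase (proj₁ (proj₂ sp) l c eq)) (sym (*-identityˡ (p c))))
  ... | fwd  = trans (phase-ω (proj₁ sp l)) (trans (cong phase (sym (proj₂ (proj₂ sp) l c eq))) (sym (*-identityˡ (p c))))
  ... | bwd  = trans (cong (λ k → phase k ⊛ ω̄) (proj₂ (proj₂ sp) c l (trans (consistent M l c) (cong rev eq))))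
                 (trans (phase-ω̄ (proj₁ sp c)) (sym (*-identityˡ (p c))))

  D≡degree⊛δ : ∀ l c → D M l c ≡ fromℕω (degree M l) ⊛ δ l c
  D≡degree⊛δ l c with does (l Fin.≟ c)
  ... | true  = sym (*-identityʳ (fromℕω (degree M l)))
  ... | false = sym (zeroʳ (fromℕω (degree M l)))

  gauge-L : ∀ l c → p l ⊛ L M l c
    ≡ sum (λ x → fromBool (isEdge (arc M l x))) ⊛ (p l ⊛ δ l c) ⊖ fromBool (isEdge (arc M l c)) ⊛ p c
  gauge-L l c = begin
    p l ⊛ (D M l c ⊖ N M l c)
      ≡⟨ distribˡ (p l) (D M l c) (⊖ N M l c) ⟩
    p l ⊛ D M l c ⊕ p l ⊛ (⊖ N M l c)
      ≡⟨ cong (p l ⊛ D M l c ⊕_) (-‿distribʳ-* (p l) (N M l c)) ⟨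
    p l ⊛ D M l c ⊖ p l ⊛ N M l c
      ≡⟨ cong₂ _⊖_ diagonal (gauge-N l c) ⟩
    sum (λ x → fromBool (isEdge (arc M l x))) ⊛ (p l ⊛ δ l c) ⊖ fromBool (isEdge (arc M l c)) ⊛ p c ∎
    where
    open CommutativeRing ⊕-⊛-commutativeRing using (*-assoc; *-comm)
    d = fromℕω (degree M l)
    diagonal : p l ⊛ D M l c ≡ sum (λ x → fromBool (isEdge (arc M l x))) ⊛ (p l ⊛ δ l c)
    diagonal = begin
      p l ⊛ D M l c          ≡⟨ cong (p l ⊛_) (D≡degree⊛δ l c) ⟩
      p l ⊛ (d ⊛ δ l c)      ≡⟨ *-assoc (p l) d (δ l c) ⟨
      p l ⊛ d ⊛ δ l c        ≡⟨ cong (_⊛ δ l c) (*-comm (p l) d) ⟩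
      d ⊛ p l ⊛ δ l c        ≡⟨ *-assoc d (p l) (δ l c) ⟩
      d ⊛ (p l ⊛ δ l c)      ≡⟨ cong (_⊛ (p l ⊛ δ l c)) (trans (cong fromℕω (degree-count M l)) (fromℕω-count (isEdge ∘ arc M l))) ⟩
      sum (λ x → fromBool (isEdge (arc M l x))) ⊛ (p l ⊛ δ l c) ∎

  -- Both products of phases in `gauged-matrix-tree` have norm one, so only the count survives,
  -- squared because `normω` is the squared absolute value. The count still refers to the root `i`.
  normω-cofactor : ∀ i j → let k = length (arborescences (SpanningTrees.adjacency M i) i) in
    normω (cofactor (L M) i j) ≡ + k ℤ.* + k
  normω-cofactor i j = begin
    normω (cofactor (L M) i j)                       ≡⟨ cong normω (cofactor≡cofactorAt (L M) i j) ⟩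
    normω (cofactorAt (L M) i j)                     ≡⟨ ℤ.*-identityˡ _ ⟨
    + 1 ℤ.* normω (cofactorAt (L M) i j)             ≡⟨ cong (ℤ._* normω (cofactorAt (L M) i j)) (normω-product s unit-s) ⟨
    normω (product s) ℤ.* normω (cofactorAt (L M) i j) ≡⟨ normω-⊛ (product s) (cofactorAt (L M) i j) ⟨
    normω (product s ⊛ cofactorAt (L M) i j)         ≡⟨ cong normω (gauged-matrix-tree (SpanningTrees.adjacency M i) p (L M) gauge-L i j) ⟩
    normω (k ×ω product p)                           ≡⟨ cong normω (×ω≡fromℕω k (product p)) ⟩
    normω (fromℕω k ⊛ product p)                     ≡⟨ normω-⊛ (fromℕω k) (product p) ⟩
    normω (fromℕω k) ℤ.* normω (product p)           ≡⟨ cong₂ ℤ._*_ (normω-fromℕω k) (normω-product p (normω-phase ∘ proj₁ sp)) ⟩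
    (+ k ℤ.* + k) ℤ.* + 1                            ≡⟨ ℤ.*-identityʳ _ ⟩
    + k ℤ.* + k                                      ∎
    where
    k = length (arborescences (SpanningTrees.adjacency M i) i)
    s = p [ i ≔ p j ]
    unit-s : ∀ l → normω (s l) ≡ + 1
    unit-s = ≔-elim (λ _ x → normω x ≡ + 1) {p} {i} (normω-phase (proj₁ sp j)) (λ l _ → normω-phase (proj₁ sp l))

cardinality-unique : ∀ {a} {A : Set a} {m n} → Fin m ⤖ A → Fin n ⤖ A → m ≡ n
cardinality-unique f g = ↔⇒≡ (↔-trans (⤖⇒↔ f) (↔-sym (⤖⇒↔ g)))

open import Data.Integer using (_*_)

theorem3p7 : (n : ℕ) (M : MixedGraph n) → Connected (Adj M) → PropertySP M →
    (∀ i j k l → normω (cofactor (L M) i j) ≡ normω (cofactor (L M) k l)) ×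
    (∀ (t : ℕ) → Fin t ⤖ SpanningTree M →
    ∀ i j → normω (cofactor (L M) i j) ≡ (+ t) * (+ t))
theorem3p7 zero    M _ sp = (λ ()) , (λ _ _ ())
theorem3p7 (suc n) M _ sp = all-equal , count-trees
  where
  count-trees : ∀ t → Fin t ⤖ SpanningTree M → ∀ i j → normω (cofactor (L M) i j) ≡ (+ t) * (+ t)
  count-trees t trees i j = trans (normω-cofactor M sp i j)
    (cong (λ k → + k * + k) (cardinality-unique (SpanningTrees.arborescences⤖spanningTrees M i) trees))
  all-equal : ∀ i j k l → normω (cofactor (L M) i j) ≡ normω (cofactor (L M) k l)
  -- The arborescences rooted at `i` serve as the enumeration of the spanning trees for the cofactor
  -- in row `k` too, so both sides become the square of the same number.
  all-equal i j k l = trans (normω-cofactor M sp i j)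
    (sym (count-trees _ (SpanningTrees.arborescences⤖spanningTrees M i) k l))
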